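{- Let $n$ be a squarefree positive integer such that every prime divisor of $n$ is at least $7$. Suppose $p'$ is a prime divisor of $n$ and $\Omega(n)=3$, and put $n'=n/p'$. Then a sequence in $\mathbb{Z}_n$ is a $D$-extremal sequence for $L(n;p')$ if and only if either it is a $D$-extremal sequence for $U(n)$ or it is a permutation of a sequence $(x_1,x_2,x_3)$ in $\mathbb{Z}_n$ which has one of the following forms: (i) the image of the sequence $(x_1,x_2)$ under $f_{n|n'}$ is a $D$-extremal sequence for $S(n')$, and $x_3$ is a non-zero multiple of $n'$ (in $\mathbb{Z}_n$); (ii) the only term of $(x_1,x_2,x_3)$ which is not divisible by $p'$ is $x_1$, and the image of the sequence $(x_2,x_3)$ under $f_{n|n'}$ is a $D$-extremal sequence for $S(n')$ which is not a $D$-extremal sequence for $U(n')$.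
   Context: For a positive integer $m$, $\mathbb{Z}_m$ denotes the ring $\mathbb{Z}/m\mathbb{Z}$ and $U(m)$ its group of units. For odd $m$ and $x\in U(m)$, $\left(\frac{x}{m}\right)$ denotes the Jacobi symbol, and $S(m)=\{x\in U(m):\left(\frac{x}{m}\right)=1\}$. For a prime divisor $p$ of $n$, $L(n;p)=\{a\in U(n):\left(\frac{a}{n}\right)=\left(\frac{a}{p}\right)\}$. For squarefree $n$, $\Omega(n)$ is the number of prime divisors of $n$. For a divisor $m$ of $n$, $f_{n|m}:\mathbb{Z}_n\to\mathbb{Z}_m$ is the natural map $a+n\mathbb{Z}\mapsto a+m\mathbb{Z}$, applied to sequences term by term. For $A\subseteq\mathbb{Z}_m$, a (nonempty, finite) sequence $(y_1,\ldots,y_k)$ in $\mathbb{Z}_m$ is an $A$-weighted zero-sum sequence if there exist $a_1,\ldots,a_k\in A$ with $a_1y_1+\cdots+a_ky_k=0$. The $A$-weighted Davenport constant $D_A(m)$ is the least positive integer $k$ such that every sequence of length $k$ in $\mathbb{Z}_m$ has a (nonempty) subsequence, not necessarily of consecutive terms, that is an $A$-weighted zero-sum sequence. If $0\notin A$, a $D$-extremal sequence for $A$ is a sequence in $\mathbb{Z}_m$ of length $D_A(m)-1$ which has no $A$-weighted zero-sum subsequence. -}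

module Defs where

open import Data.Bool.Base using (if_then_else_)
open import Data.Fin.Base using (Fin; toℕ)
open import Data.Fin.Properties using (any?)
open import Data.Integer.Base as ℤ using (ℤ; 0ℤ; 1ℤ; -1ℤ)
open import Data.List.Base using (List; []; length; map; foldr; zipWith)
open import Data.List.Relation.Binary.Sublist.Propositional using (_⊆_)
open import Data.List.Relation.Unary.All using (All)
open import Data.Nat.Base using (ℕ; _+_; _*_; _∸_; _≤_; _<_; NonZero; ∣_-_∣)
open import Data.Nat.Divisibility using (_∣_; _∣?_)
open import Data.Nat.DivMod using (_mod_)
open import Data.Nat.Primality.Factorisation using (factors; factorise)
open import Data.Product.Base using (∃; ∃-syntax; _×_)
open import Level using (0ℓ)
open import Relation.Binary.PropositionalEquality.Core using (_≡_; _≢_)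
open import Relation.Nullary.Decidable.Core using (does)
open import Relation.Nullary.Negation.Core using (¬_)
open import Relation.Unary using (Pred; _∈_; _∉_)

------------------------------------------------------------------------
-- Arithmetic in ℕ

Squarefree : Pred ℕ 0ℓ
Squarefree n = ∀ d → d * d ∣ n → d ≡ 1

-- Prime factors are counted with multiplicity; for squarefree n this is
-- the number of prime divisors of n.
Ω : (n : ℕ) .{{_ : NonZero n}} → ℕ
Ω n = length (factors (factorise n))

-- Meaningful for odd primes p only. The divisibility says that x² and a
-- are congruent modulo p.
legendre : ℕ → ℕ → ℤ
legendre a p =
  if does (p ∣? a) then 0ℤ
  else if does (any? λ (x : Fin p) → p ∣? ∣ toℕ x * toℕ x - a ∣) then 1ℤ
  else -1ℤ

-- Meaningful for odd m only.
jacobi : ℕ → (m : ℕ) .{{_ : NonZero m}} → ℤ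
jacobi a m = foldr ℤ._*_ 1ℤ (map (legendre a) (factors (factorise m)))

------------------------------------------------------------------------
-- The ring of integers modulo m, on the least non-negative residues

infix 9 ℤ/_

ℤ/_ : ℕ → Set
ℤ/ m = Fin m

-- The residue class of a; the modulus is determined by the context.
⟦_⟧ : {m : ℕ} .{{_ : NonZero m}} → ℕ → ℤ/ m
⟦_⟧ {m} a = a mod m

module _ {m : ℕ} .{{_ : NonZero m}} where

  infixl 6 _+ₘ_
  infixl 7 _*ₘ_
  infix  4 _∣ₘ_

  _+ₘ_ : ℤ/ m → ℤ/ m → ℤ/ m
  x +ₘ y = ⟦ toℕ x + toℕ y ⟧

  _*ₘ_ : ℤ/ m → ℤ/ m → ℤ/ m
  x *ₘ y = ⟦ toℕ x * toℕ y ⟧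

  sumₘ : List (ℤ/ m) → ℤ/ m
  sumₘ = foldr _+ₘ_ ⟦ 0 ⟧

  _∣ₘ_ : ℤ/ m → ℤ/ m → Set
  x ∣ₘ y = ∃[ c ] c *ₘ x ≡ y

-- The natural map from ℤ/ n to ℤ/ m; it is a ring homomorphism only when
-- m ∣ n.
reduce : (n m : ℕ) .{{_ : NonZero m}} → ℤ/ n → ℤ/ m
reduce n m a = ⟦ toℕ a ⟧

U : (m : ℕ) .{{_ : NonZero m}} → Pred (ℤ/ m) 0ℓ
U m x = ∃[ y ] x *ₘ y ≡ ⟦ 1 ⟧

S : (m : ℕ) .{{_ : NonZero m}} → Pred (ℤ/ m) 0ℓ
S m x = x ∈ U m × jacobi (toℕ x) m ≡ 1ℤ

-- Intended for p a prime divisor of n, so that the symbol over p does not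
-- depend on the representative of a.
L : (n p : ℕ) .{{_ : NonZero n}} .{{_ : NonZero p}} → Pred (ℤ/ n) 0ℓ
L n p a = a ∈ U n × jacobi (toℕ a) n ≡ jacobi (toℕ a) p

------------------------------------------------------------------------
-- Weighted zero-sum sequences

module _ {m : ℕ} .{{_ : NonZero m}} (A : Pred (ℤ/ m) 0ℓ) where

  IsWeightedZeroSum : Pred (List (ℤ/ m)) 0ℓ
  IsWeightedZeroSum ys =
    ys ≢ [] ×
    ∃[ as ] length as ≡ length ys × All A as × sumₘ (zipWith _*ₘ_ as ys) ≡ ⟦ 0 ⟧

  HasWeightedZeroSumSubsequence : Pred (List (ℤ/ m)) 0ℓ
  HasWeightedZeroSumSubsequence xs = ∃[ ys ] ys ⊆ xs × IsWeightedZeroSum ys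

  EverySequenceOfLength : Pred ℕ 0ℓ
  EverySequenceOfLength k =
    (xs : List (ℤ/ m)) → length xs ≡ k → HasWeightedZeroSumSubsequence xs

  -- "k is the least positive integer with the property", as a relation, so
  -- that no proof of existence is needed to state it.
  IsDavenportConstant : Pred ℕ 0ℓ
  IsDavenportConstant k =
    0 < k × EverySequenceOfLength k ×
    (∀ j → 0 < j → EverySequenceOfLength j → k ≤ j)

  -- The notion is only defined for sets of weights not containing zero.
  IsDExtremal : Pred (List (ℤ/ m)) 0ℓ
  IsDExtremal xs =
    ⟦ 0 ⟧ ∉ A ×
    (∃[ k ] IsDavenportConstant k × length xs ≡ k ∸ 1) ×
    ¬ HasWeightedZeroSumSubsequence xs

{-# OPTIONS --safe #-}

-- By the Chinese remainder theorem write n = q r p with p = p′, so that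
-- L(n; p′) consists of the units u whose quadratic characters modulo q and r
-- agree, with no condition modulo p.  When the quadratic characters of the
-- weights are prescribed, the values of a weighted sum of y₁, …, yₖ modulo a
-- prime ≥ 7 depend only on the classes (zero, square, nonsquare) of the yᵢ and
-- form one of {0}, a coset of the squares, all units, or everything: two
-- nonzero terms already reach every unit.  A finite automaton that reads these
-- classes and stores the set of reachable values therefore decides whether a
-- sequence has a weighted zero-sum subsequence.  Up to scaling by weights only
-- ten kinds of terms exist in ℤ/n, and both the Davenport constants and the
-- classification of sequences of length three follow by exhaustion.

module Submission where

open import Defs
open import Data.Bool.Base using (Bool; true; false; T; _∧_; _∨_; not)
open import Data.Bool.ListAction using (any; all)
open import Data.Bool.Properties using (T-∧; T-∨)
open import Data.Empty using (⊥-elim)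
open import Data.Fin.Base as Fin using (Fin; toℕ; fromℕ<; splitAt; join)
open import Data.Fin.Properties using (any?; pigeonhole; toℕ-fromℕ<; toℕ<n; toℕ-injective; join-splitAt; <⇒≢)
open import Data.Integer.Base as Int using (ℤ; +_; -[1+_]; 0ℤ; 1ℤ; -1ℤ; ∣_∣; _⊖_)
open import Data.Integer.DivMod using (_%ℕ_; _/ℕ_; n%ℕd<d; a≡a%ℕn+[a/ℕn]*n)
import Data.Integer.Divisibility.Signed as ℤ∣
open ℤ∣ using (divides)
import Data.Integer.Properties as ℤₚ
open import Data.Integer.Tactic.RingSolver using (solve-∀)
open import Data.List.Base using (List; []; _∷_; map; cartesianProduct; length; zipWith; take; foldr; null)
open import Data.List.Properties using (length-take; map-∘; map-cong)
open import Data.List.Membership.Propositional using (_∈_; find; lose)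
open import Data.List.Membership.Propositional.Properties using (∈-map⁺; ∈-map⁻; ∈-cartesianProduct⁺; ∈-cartesianProduct⁻)
open import Data.List.Relation.Binary.Permutation.Propositional as Perm using (_↭_; ↭-sym; ↭⇒↭ₛ)
import Data.List.Relation.Binary.Permutation.Propositional.Properties as Permₚ
import Data.List.Relation.Binary.Permutation.Setoid.Properties as PermSetoid
open import Data.List.Relation.Binary.Sublist.Propositional using (_⊆_; []; _∷_; _∷ʳ_; ⊆-trans)
open import Data.List.Relation.Binary.Sublist.Propositional.Properties using (take-⊆)
open import Data.List.Relation.Unary.All as All using (All; []; _∷_)
open import Data.List.Relation.Unary.All.Properties using (all⁺)
open import Data.List.Relation.Unary.Any using (here; there)
open import Data.List.Relation.Unary.Any.Properties using (any⁺; any⁻)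
open import Data.Nat.Base as ℕ using (ℕ; zero; suc; NonZero; z≤n; s≤s)
open import Data.Nat.Coprimality as Coprimality using (Coprime; coprime-Bézout; coprime-divisor)
import Data.Nat.Divisibility as ℕ∣
open import Data.Nat.DivMod using (m≡m%n+[m/n]*n; m%n<n)
open import Data.Nat.GCD using (module Bézout)
open import Data.Nat.ListAction using (product)
open import Data.Nat.Primality using (Prime; euclidsLemma; prime⇒irreducible; prime⇒nonZero; ¬prime[1])
open import Data.Nat.Primality.Factorisation using (PrimeFactorisation; factorise; factorisationUnique; factorisationHasAllPrimeFactors)
import Data.Nat.Properties as ℕₚ
open import Data.Nat.Tactic.RingSolver using () renaming (solve-∀ to ℕ-solve-∀)
open import Data.Product.Base using (∃-syntax; ∃₂; _×_; _,_; proj₁; proj₂)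
open import Data.Product.Function.NonDependent.Propositional using (_×-⇔_)
open import Data.Sign.Base as Sign using (Sign)
import Data.Sign.Properties as Signₚ
open import Data.Sum.Base using (_⊎_; inj₁; inj₂; [_,_]′; map₂)
open import Data.Unit.Base using (⊤; tt)
open import Function.Base using (_∘_; id)
open import Function.Bundles using (module Equivalence; _⇔_; mk⇔)
open Equivalence using (to; from)
open import Function.Properties.Equivalence using () renaming (sym to ⇔-sym; trans to ⇔-trans)
open import Level using (0ℓ)
open import Relation.Binary.Bundles using (Setoid)
open import Relation.Binary.PropositionalEquality.Core using (_≡_; _≢_; refl; sym; trans; cong; cong₂; subst)
open import Relation.Binary.PropositionalEquality.Properties using (setoid)
import Relation.Binary.Reasoning.Setoid as SetoidReasoning
open import Relation.Nullary.Decidable using (Dec; yes; no; map′; ¬?; decidable-stable)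
open import Relation.Nullary.Negation.Core using (¬_; contradiction)
open import Relation.Unary using (Pred)


-- Congruences and prime fields

-- The obstacle is a coupling: a weight has the same quadratic character modulo q and modulo r, so
-- the values reachable modulo q r do not form a product of two ranges but only a union of such
-- products, one for each choice of the signs of the weights. The automaton for `S` is therefore
-- nondeterministic, with one transition for each common sign, whereas the prime p is independent
-- and enters through a product of automata. Besides the classes of the terms, the transitions
-- depend only on the characters of -1 modulo q and r, which decide whether elements of two cosets
-- of the squares can cancel; this is why the exhaustion also runs over two signs. The bound 7 is
-- tied to 3² + 4² = 5²: every unit has to be a sum of two units of any prescribed characters, and
-- modulo 5 the residue 1 is not a sum of two nonzero squares. Terms and weights are handled as
-- integers, so that one number can be read modulo each of the primes and modulo n, and weights
-- found for different moduli can be merged into one.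

module Congruence (m : ℤ) where
  open Int using (_+_; _*_; _-_; -_)
  open ℤ∣ using (_∣_)

  infix 4 _≈_ _≉_

  record _≈_ (x y : ℤ) : Set where
    constructor congruent
    field difference : m ∣ x - y
  open _≈_ public

  _≉_ : ℤ → ℤ → Set
  x ≉ y = ¬ (x ≈ y)

  private
    variable
      x y z w : ℤ

    by : x ≡ y → m ∣ x → m ∣ y
    by refl d = d

  ≈-refl : x ≈ x
  ≈-refl {x} = congruent (divides 0ℤ (ℤₚ.+-inverseʳ x))

  ≈-reflexive : x ≡ y → x ≈ y
  ≈-reflexive refl = ≈-refl

  ≈-sym : x ≈ y → y ≈ x
  ≈-sym {x} {y} (congruent d) = congruent (by (lemma x y) (ℤ∣.∣m⇒∣-m d))
    where
    lemma : ∀ x y → - (x - y) ≡ y - x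
    lemma = solve-∀

  ≈-trans : x ≈ y → y ≈ z → x ≈ z
  ≈-trans {x} {y} {z} (congruent d) (congruent e) = congruent (by (lemma x y z) (ℤ∣.∣m∣n⇒∣m+n d e))
    where
    lemma : ∀ x y z → (x - y) + (y - z) ≡ x - z
    lemma = solve-∀

  ≈-setoid : Setoid _ _
  ≈-setoid = record
    { _≈_ = _≈_
    ; isEquivalence = record { refl = ≈-refl ; sym = ≈-sym ; trans = ≈-trans }
    }

  module ≈-Reasoning = SetoidReasoning ≈-setoid

  +-cong : x ≈ y → z ≈ w → x + z ≈ y + w
  +-cong {x} {y} {z} {w} (congruent d) (congruent e) = congruent (by (lemma x y z w) (ℤ∣.∣m∣n⇒∣m+n d e))
    where
    lemma : ∀ x y z w → (x - y) + (z - w) ≡ (x + z) - (y + w)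
    lemma = solve-∀

  -‿cong : x ≈ y → - x ≈ - y
  -‿cong {x} {y} (congruent d) = congruent (by (lemma x y) (ℤ∣.∣m⇒∣-m d))
    where
    lemma : ∀ x y → - (x - y) ≡ (- x) - (- y)
    lemma = solve-∀

  *-cong : x ≈ y → z ≈ w → x * z ≈ y * w
  *-cong {x} {y} {z} {w} (congruent d) (congruent e) =
    congruent (by (lemma x y z w) (ℤ∣.∣m∣n⇒∣m+n (ℤ∣.∣m⇒∣m*n z d) (ℤ∣.∣n⇒∣m*n y e)))
    where
    lemma : ∀ x y z w → (x - y) * z + y * (z - w) ≡ x * z - y * w
    lemma = solve-∀

  *-congˡ : ∀ x → y ≈ z → x * y ≈ x * z
  *-congˡ x e = *-cong (≈-refl {x}) e

  *-congʳ : ∀ z → x ≈ y → x * z ≈ y * z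
  *-congʳ z e = *-cong e (≈-refl {z})

  ∣⇒≈0 : m ∣ x → x ≈ 0ℤ
  ∣⇒≈0 {x} d = congruent (by (sym (ℤₚ.+-identityʳ x)) d)

  ≈0⇒∣ : x ≈ 0ℤ → m ∣ x
  ≈0⇒∣ {x} (congruent d) = by (ℤₚ.+-identityʳ x) d

  -≈0⇒≈ : x - y ≈ 0ℤ → x ≈ y
  -≈0⇒≈ e = congruent (≈0⇒∣ e)

  ≈⇒-≈0 : x ≈ y → x - y ≈ 0ℤ
  ≈⇒-≈0 (congruent d) = ∣⇒≈0 d

  infix 4 _≈?_
  _≈?_ : ∀ x y → Dec (x ≈ y)
  x ≈? y = map′ congruent difference (m ℤ∣.∣? (x - y))

abstract
  residue : ∀ m .{{_ : NonZero m}} → ℤ → Fin m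
  residue m x = fromℕ< (n%ℕd<d x m)

  residue-≈ : ∀ m .{{_ : NonZero m}} x → Congruence._≈_ (+ m) (+ toℕ (residue m x)) x
  residue-≈ m x = ≈-sym (congruent (divides (x /ℕ m)
    (trans (cong₂ Int._-_ (a≡a%ℕn+[a/ℕn]*n x m) (cong +_ (toℕ-fromℕ< (n%ℕd<d x m))))
           (lemma (+ (x %ℕ m)) (x /ℕ m Int.* + m)))))
    where
    open Congruence (+ m)
    lemma : ∀ a b → (a Int.+ b) Int.- a ≡ b
    lemma = solve-∀

≈-small⇒≡ : ∀ {m i j} → i ℕ.< m → j ℕ.< m → Congruence._≈_ (+ m) (+ i) (+ j) → i ≡ j
≈-small⇒≡ {m} {i} {j} i<m j<m (Congruence.congruent d)
  with ∣ + i Int.- + j ∣ in eq | ℤ∣.∣⇒∣ᵤ d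
... | zero  | _ = ℤₚ.+-injective (ℤₚ.i-j≡0⇒i≡j (+ i) (+ j) (ℤₚ.∣i∣≡0⇒i≡0 eq))
... | suc k | d′ = contradiction (ℕ∣.∣⇒≤ d′) (ℕₚ.<⇒≱ k<m)
  where
  k<m : suc k ℕ.< m
  k<m = subst (ℕ._< m) eq
    (ℕₚ.≤-<-trans (ℕₚ.≤-trans (ℕₚ.≤-reflexive (cong ∣_∣ (ℤₚ.m-n≡m⊖n i j))) (ℤₚ.∣m⊝n∣≤m⊔n i j)) (ℕₚ.⊔-pres-<m i<m j<m))

module _ where
  open Int using (_+_; _*_; _-_; -_)

  abstract
    bézout : ∀ {m n} → Coprime m n → ∃₂ λ s t → s * + m + t * + n ≡ 1ℤ
    bézout {m} {n} c with coprime-Bézout c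
    ... | Bézout.+- x y eq = + x , - + y , trans (cong (_+ (- + y * + n)) lhs) (lemma (+ y) (+ n))
      where
      lhs : + x * + m ≡ 1ℤ + + y * + n
      lhs = trans (sym (ℤₚ.pos-* x m)) (trans (cong +_ (sym eq)) (cong (λ z → 1ℤ + z) (ℤₚ.pos-* y n)))
      lemma : ∀ y n → (1ℤ + y * n) + (- y * n) ≡ 1ℤ
      lemma = solve-∀
    ... | Bézout.-+ x y eq = - + x , + y , trans (cong (λ z → (- + x * + m) + z) rhs) (lemma (+ x) (+ m))
      where
      rhs : + y * + n ≡ 1ℤ + + x * + m
      rhs = trans (sym (ℤₚ.pos-* y n)) (trans (cong +_ (sym eq)) (cong (λ z → 1ℤ + z) (ℤₚ.pos-* x m)))
      lemma : ∀ x m → (- x * m) + (1ℤ + x * m) ≡ 1ℤ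
      lemma = solve-∀

    chinese-remainder : ∀ {m n} → Coprime m n → ∀ x y →
      ∃[ z ] (Congruence._≈_ (+ m) z x × Congruence._≈_ (+ n) z y)
    chinese-remainder {m} {n} c x y with s , t , eq ← bézout c =
      z , Congruence.congruent (divides (s * (y - x)) left)
        , Congruence.congruent (divides (t * (x - y)) right)
      where
      z : ℤ
      z = x * (t * + n) + y * (s * + m)
      lemmaˡ : ∀ x y sm tn → (x * tn + y * sm) - x * (sm + tn) ≡ (y - x) * sm
      lemmaˡ = solve-∀
      lemmaʳ : ∀ x y sm tn → (x * tn + y * sm) - y * (sm + tn) ≡ (x - y) * tn
      lemmaʳ = solve-∀
      assoc : ∀ s d m → d * (s * m) ≡ s * d * m
      assoc = solve-∀
      unit : ∀ x → x ≡ x * (s * + m + t * + n)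
      unit x = trans (sym (ℤₚ.*-identityʳ x)) (cong (x *_) (sym eq))
      left : z - x ≡ s * (y - x) * + m
      left = trans (cong (λ w → z - w) (unit x)) (trans (lemmaˡ x y (s * + m) (t * + n)) (assoc s (y - x) (+ m)))
      right : z - y ≡ t * (x - y) * + n
      right = trans (cong (λ w → z - w) (unit y)) (trans (lemmaʳ x y (s * + m) (t * + n)) (assoc t (x - y) (+ n)))

prime∤⇒coprime : ∀ {p k} → Prime p → ¬ (p ℕ∣.∣ k) → Coprime p k
prime∤⇒coprime pr p∤k (d∣p , d∣k) with prime⇒irreducible pr d∣p
... | inj₁ d≡1 = d≡1
... | inj₂ refl = contradiction d∣k p∤k

module PrimeField {p : ℕ} (p-prime : Prime p) where
  open Int using (_+_; _*_; _-_; -_)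
  open Congruence (+ p) public

  private
    variable
      x y z : ℤ

    instance
      p≢0 : NonZero p
      p≢0 = prime⇒nonZero p-prime

  ≈0⇒∣ᵤ : x ≈ 0ℤ → p ℕ∣.∣ ∣ x ∣
  ≈0⇒∣ᵤ = ℤ∣.∣⇒∣ᵤ ∘ ≈0⇒∣

  ∣ᵤ⇒≈0 : p ℕ∣.∣ ∣ x ∣ → x ≈ 0ℤ
  ∣ᵤ⇒≈0 = ∣⇒≈0 ∘ ℤ∣.∣ᵤ⇒∣

  *≈0⇒≈0 : x * y ≈ 0ℤ → x ≈ 0ℤ ⊎ y ≈ 0ℤ
  *≈0⇒≈0 {x} {y} e with euclidsLemma ∣ x ∣ ∣ y ∣ p-prime (subst (p ℕ∣.∣_) (ℤₚ.abs-* x y) (≈0⇒∣ᵤ e))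
  ... | inj₁ d = inj₁ (∣ᵤ⇒≈0 d)
  ... | inj₂ d = inj₂ (∣ᵤ⇒≈0 d)

  *-≉0 : x ≉ 0ℤ → y ≉ 0ℤ → x * y ≉ 0ℤ
  *-≉0 x≉0 y≉0 = [ x≉0 , y≉0 ]′ ∘ *≈0⇒≈0

  zeroˡ : ∀ y → x ≈ 0ℤ → x * y ≈ 0ℤ
  zeroˡ y e = ≈-trans (*-congʳ y e) (≈-reflexive (ℤₚ.*-zeroˡ y))

  zeroʳ : ∀ x → y ≈ 0ℤ → x * y ≈ 0ℤ
  zeroʳ x e = ≈-trans (*-congˡ x e) (≈-reflexive (ℤₚ.*-zeroʳ x))

  *-cancelˡ : x ≉ 0ℤ → x * y ≈ x * z → y ≈ z
  *-cancelˡ {x} {y} {z} x≉0 e =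
    [ (λ x≈0 → contradiction x≈0 x≉0) , -≈0⇒≈ ]′
      (*≈0⇒≈0 (≈-trans (≈-reflexive (lemma x y z)) (≈⇒-≈0 e)))
    where
    lemma : ∀ x y z → x * (y - z) ≡ x * y - x * z
    lemma = solve-∀

  ≉0-small : ∀ {k} → 0 ℕ.< k → k ℕ.< p → + k ≉ 0ℤ
  ≉0-small {suc _} _ k<p e = ℕₚ.<⇒≱ k<p (ℕ∣.∣⇒≤ (≈0⇒∣ᵤ e))

  1≉0 : 1ℤ ≉ 0ℤ
  1≉0 e = ¬prime[1] (subst Prime (ℕ∣.∣1⇒≡1 (≈0⇒∣ᵤ e)) p-prime)

  abstract
    inverse : x ≉ 0ℤ → ∃[ y ] x * y ≈ 1ℤ
    inverse {x} x≉0 with s , t , eq ← bézout (prime∤⇒coprime p-prime (x≉0 ∘ ∣ᵤ⇒≈0)) =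
      -- Bézout inverts the absolute value of `x`; if `x` is negative, the sign is passed on to the
      -- inverse.
      [ (λ e → t , result e eq)
      , (λ e → - t , trans′ (lemma x t) (result′ e eq)) ]′ (sign-cases x)
      where
      sign-cases : ∀ x → + ∣ x ∣ ≡ x ⊎ + ∣ x ∣ ≡ - x
      sign-cases (+ _)    = inj₁ refl
      sign-cases -[1+ _ ] = inj₂ refl
      lemma : ∀ x t → t * - x ≡ x * - t
      lemma = solve-∀
      trans′ : ∀ {a b c} → a ≡ b → a ≈ c → b ≈ c
      trans′ refl e = e
      core : ∀ {X} → s * + p + t * X ≡ 1ℤ → t * X ≈ 1ℤ
      core {X} eq = ≈-sym (congruent (divides s (trans (cong (_- (t * X)) (sym eq)) (cancel (s * + p) (t * X)))))
        where
        cancel : ∀ a b → (a + b) - b ≡ a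
        cancel = solve-∀
      result : + ∣ x ∣ ≡ x → s * + p + t * + ∣ x ∣ ≡ 1ℤ → x * t ≈ 1ℤ
      result e eq = trans′ (ℤₚ.*-comm t x) (core (trans (cong (λ X → s * + p + t * X) (sym e)) eq))
      result′ : + ∣ x ∣ ≡ - x → s * + p + t * + ∣ x ∣ ≡ 1ℤ → t * - x ≈ 1ℤ
      result′ e eq = core (trans (cong (λ X → s * + p + t * X) (sym e)) eq)

  *≈1⇒≉0 : x * y ≈ 1ℤ → x ≉ 0ℤ
  *≈1⇒≉0 {x} {y} e x≈0 = 1≉0 (≈-trans (≈-sym e) (zeroˡ y x≈0))

  squares-≈ : x * x ≈ y * y → x ≈ y ⊎ x + y ≈ 0ℤ
  squares-≈ {x} {y} e = [ inj₁ ∘ -≈0⇒≈ , inj₂ ]′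
    (*≈0⇒≈0 {x - y} {x + y} (≈-trans (≈-reflexive (lemma x y)) (≈⇒-≈0 e)))
    where
    lemma : ∀ x y → (x - y) * (x + y) ≡ x * x - y * y
    lemma = solve-∀

  Square : ℤ → Set
  Square x = ∃[ y ] y * y ≈ x

  square-resp : x ≈ y → Square x → Square y
  square-resp x≈y (r , e) = r , ≈-trans e x≈y

  square-* : Square x → Square y → Square (x * y)
  square-* (r , e) (s , f) = r * s , ≈-trans (≈-reflexive (lemma r s)) (*-cong e f)
    where
    lemma : ∀ r s → r * s * (r * s) ≡ (r * r) * (s * s)
    lemma = solve-∀

  -- If y = r² and x y = s², then s / r is a root of x.
  square-quotient : y ≉ 0ℤ → Square y → Square (x * y) → Square x
  square-quotient {y} {x} y≉0 (r , r²≈y) (s , s²≈xy) = s * i , (begin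
      s * i * (s * i)         ≡⟨ lemma₁ s i ⟩
      (s * s) * (i * i)       ≈⟨ *-congʳ (i * i) s²≈xy ⟩
      x * y * (i * i)         ≈⟨ *-congʳ (i * i) (*-congˡ x (≈-sym r²≈y)) ⟩
      x * (r * r) * (i * i)   ≡⟨ lemma₂ x r i ⟩
      x * ((r * i) * (r * i)) ≈⟨ *-congˡ x (*-cong {r * i} {1ℤ} ri≈1 ri≈1) ⟩
      x * (1ℤ * 1ℤ)           ≡⟨ ℤₚ.*-identityʳ x ⟩
      x                       ∎)
    where
    open ≈-Reasoning
    r⁻¹ : ∃[ i ] r * i ≈ 1ℤ
    r⁻¹ = inverse {r} (λ r≈0 → y≉0 (≈-trans (≈-sym r²≈y) (zeroˡ r r≈0)))
    i = proj₁ r⁻¹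
    ri≈1 = proj₂ r⁻¹
    lemma₁ : ∀ s i → s * i * (s * i) ≡ (s * s) * (i * i)
    lemma₁ = solve-∀
    lemma₂ : ∀ x r i → x * (r * r) * (i * i) ≡ x * ((r * i) * (r * i))
    lemma₂ = solve-∀

  square? : ∀ x → Dec (Square x)
  square? x = map′ (λ (i , e) → + toℕ i , e) reduce-root (any? λ (i : Fin p) → + toℕ i * + toℕ i ≈? x)
    where
    reduce-root : Square x → ∃[ i ] + toℕ {p} i * + toℕ i ≈ x
    reduce-root (r , e) = residue p r , ≈-trans (*-cong (residue-≈ p r) (residue-≈ p r)) e

  pigeonhole-≈ : ∀ {k} → p ℕ.< k → (f : Fin k → ℤ) → ∃₂ λ i j → i ≢ j × f i ≈ f j
  pigeonhole-≈ p<k f with i , j , i<j , eq ← pigeonhole p<k (residue p ∘ f) =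
    i , j , <⇒≢ i<j ,
    ≈-trans (≈-sym (residue-≈ p (f i))) (≈-trans (≈-reflexive (cong (+_ ∘ toℕ) eq)) (residue-≈ p (f j)))

-- Squares and nonsquares modulo an odd prime

module OddPrimeField {p : ℕ} (p-prime : Prime p) (2<p : 2 ℕ.< p) where
  open Int using (_+_; _*_; _-_; -_)
  open PrimeField p-prime public

  private
    variable
      x a b : ℤ

    instance
      p≢0 : NonZero p
      p≢0 = prime⇒nonZero p-prime

  -x≈x⇒x≈0 : - x ≈ x → x ≈ 0ℤ
  -x≈x⇒x≈0 {x} e = [ (λ 2≈0 → contradiction 2≈0 (≉0-small (s≤s z≤n) 2<p)) , id ]′
    (*≈0⇒≈0 {+ 2} (≈-trans (≈-reflexive (double x)) (≈⇒-≈0 (≈-sym e))))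
    where
    double : ∀ x → + 2 * x ≡ x - - x
    double = solve-∀

  -- If every residue were a square, choosing roots would embed Fin p into
  -- itself and miss one of the two roots of 1.
  ∃-nonsquare : ∃[ a ] a ≉ 0ℤ × ¬ Square a
  ∃-nonsquare with any? (λ (i : Fin p) → ¬? (square? (+ toℕ i)))
  ... | yes (i , ¬sq) = + toℕ i , (λ e → ¬sq (0ℤ , ≈-sym e)) , ¬sq
  ... | no all = ⊥-elim (collision (pigeonhole-≈ ℕₚ.≤-refl f))
    where
    root : ∀ i → Square (+ toℕ {p} i)
    root i = decidable-stable (square? _) (λ ¬sq → all (i , ¬sq))
    r : Fin p → ℤ
    r i = proj₁ (root i)
    one : Fin p
    one = residue p 1ℤ
    f : Fin (suc p) → ℤ
    f Fin.zero    = - r one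
    f (Fin.suc i) = r i
    r-square : ∀ i → r i * r i ≈ + toℕ i
    r-square i = proj₂ (root i)
    r-injective : ∀ {i j} → r i * r i ≈ r j * r j → i ≡ j
    r-injective {i} {j} e = toℕ-injective (≈-small⇒≡ (toℕ<n i) (toℕ<n j)
      (≈-trans (≈-sym (r-square i)) (≈-trans e (r-square j))))
    neg-square : ∀ x → - x * - x ≡ x * x
    neg-square = solve-∀
    r-one≉0 : r one ≉ 0ℤ
    r-one≉0 e = 1≉0 (≈-trans (≈-sym (≈-trans (r-square one) (residue-≈ p 1ℤ))) (zeroˡ (r one) e))
    clash : ∀ {i} → - r one ≉ r i
    clash {i} e = r-one≉0 (-x≈x⇒x≈0 (subst (λ j → - r one ≈ r j) (sym one≡i) e))
      where
      one≡i : one ≡ i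
      one≡i = r-injective (≈-trans (≈-reflexive (sym (neg-square (r one)))) (*-cong e e))
    collision : (∃₂ λ i j → i ≢ j × f i ≈ f j) → _
    collision (Fin.zero  , Fin.zero  , i≢j , e) = i≢j refl
    collision (Fin.zero  , Fin.suc j , i≢j , e) = clash e
    collision (Fin.suc i , Fin.zero  , i≢j , e) = clash (≈-sym e)
    collision (Fin.suc i , Fin.suc j , i≢j , e) = i≢j (cong Fin.suc (r-injective (*-cong e e)))

  private
    -- The integers 1, ..., h are one choice from each pair ±x of nonzero residues, so that their
    -- squares are distinct modulo p.
    half : ∃[ h ] p ≡ suc (h ℕ.+ h)
    half with p ℕ.% 2 in eq | m≡m%n+[m/n]*n p 2 | m%n<n p 2
    ... | 0 | e | _ = ⊥-elim (2∤p (ℕ∣.divides (p ℕ./ 2) e))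
      where
      2∤p : ¬ (2 ℕ∣.∣ p)
      2∤p d with prime⇒irreducible p-prime d
      ... | inj₂ refl = ℕₚ.<-irrefl refl 2<p
    ... | 1 | e | _ = p ℕ./ 2 , trans e (cong suc (trans (ℕₚ.*-comm (p ℕ./ 2) 2) (cong (p ℕ./ 2 ℕ.+_) (ℕₚ.+-identityʳ _))))
    ... | suc (suc _) | _ | s≤s (s≤s ())

  -- Counting: 0, b, the (p − 1)/2 nonzero squares and their multiples by a
  -- are p + 1 integers, so two of them agree modulo p.
  nonsquare-* : a ≉ 0ℤ → ¬ Square a → b ≉ 0ℤ → ¬ Square b → Square (a * b)
  nonsquare-* {a} {b} a≉0 ¬□a b≉0 ¬□b =
    let i , j , i≢j , e = pigeonhole-≈ (ℕₚ.≤-reflexive (cong suc (proj₂ half))) (value ∘ slot)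
    in clash (slot i) (slot j) (i≢j ∘ slot-injective) e
    where
    h = proj₁ half
    Slot : Set
    Slot = Fin 2 ⊎ (Fin h ⊎ Fin h)
    slot : Fin (2 ℕ.+ (h ℕ.+ h)) → Slot
    slot i = map₂ (splitAt h) (splitAt 2 i)
    unslot : Slot → Fin (2 ℕ.+ (h ℕ.+ h))
    unslot = join 2 (h ℕ.+ h) ∘ map₂ (join h h)
    unslot-slot : ∀ i → unslot (slot i) ≡ i
    unslot-slot i with splitAt 2 i in eq
    ... | inj₁ k = trans (cong (join 2 (h ℕ.+ h)) (sym eq)) (join-splitAt 2 (h ℕ.+ h) i)
    ... | inj₂ k = trans (cong (join 2 (h ℕ.+ h)) (trans (cong inj₂ (join-splitAt h h k)) (sym eq))) (join-splitAt 2 (h ℕ.+ h) i)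
    slot-injective : ∀ {i j} → slot i ≡ slot j → i ≡ j
    slot-injective {i} {j} e = trans (sym (unslot-slot i)) (trans (cong unslot e) (unslot-slot j))
    root : Fin h → ℤ
    root k = + suc (toℕ k)
    value : Slot → ℤ
    value (inj₁ Fin.zero)           = 0ℤ
    value (inj₁ (Fin.suc Fin.zero)) = b
    value (inj₂ (inj₁ k))           = root k * root k
    value (inj₂ (inj₂ k))           = a * (root k * root k)
    root<p : ∀ k → suc (toℕ k) ℕ.< p
    root<p k = subst (suc (toℕ k) ℕ.<_) (sym (proj₂ half)) (s≤s (ℕₚ.≤-trans (toℕ<n k) (ℕₚ.m≤m+n h h)))
    root≉0 : ∀ k → root k ≉ 0ℤ
    root≉0 k = ≉0-small (s≤s z≤n) (root<p k)
    □≉0 : ∀ k → root k * root k ≉ 0ℤ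
    □≉0 k = *-≉0 (root≉0 k) (root≉0 k)
    root-injective : ∀ k l → root k * root k ≈ root l * root l → k ≡ l
    root-injective k l e = [ same , opposite ]′ (squares-≈ {root k} {root l} e)
      where
      same : root k ≈ root l → k ≡ l
      same d = toℕ-injective (ℕₚ.suc-injective (≈-small⇒≡ (root<p k) (root<p l) d))
      opposite : root k + root l ≈ 0ℤ → k ≡ l
      opposite d = contradiction d (≉0-small (s≤s z≤n)
        (subst (suc (toℕ k) ℕ.+ suc (toℕ l) ℕ.<_) (sym (proj₂ half)) (s≤s (ℕₚ.+-mono-≤ (toℕ<n k) (toℕ<n l)))))
    □ : ∀ k → Square (root k * root k)
    □ k = root k , ≈-refl
    a□≉□ : ∀ k l → a * (root k * root k) ≉ root l * root l
    a□≉□ k l e = ¬□a (square-quotient (□≉0 k) (□ k) (root l , ≈-sym e))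
    -- The only coincidence that is not absurd: b = a r², and then a b = (a r)².
    found : ∀ k → a * (root k * root k) ≈ b → Square (a * b)
    found k e = a * root k , ≈-trans (≈-reflexive (lemma a (root k))) (*-congˡ a e)
      where
      lemma : ∀ a r → a * r * (a * r) ≡ a * (a * (r * r))
      lemma = solve-∀
    clash : ∀ s t → s ≢ t → value s ≈ value t → Square (a * b)
    clash (inj₁ Fin.zero)           (inj₁ Fin.zero)           s≢t e = contradiction refl s≢t
    clash (inj₁ Fin.zero)           (inj₁ (Fin.suc Fin.zero)) s≢t e = contradiction (≈-sym e) b≉0
    clash (inj₁ Fin.zero)           (inj₂ (inj₁ k))           s≢t e = contradiction (≈-sym e) (□≉0 k)
    clash (inj₁ Fin.zero)           (inj₂ (inj₂ k))           s≢t e = contradiction (≈-sym e) (*-≉0 a≉0 (□≉0 k))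
    clash (inj₁ (Fin.suc Fin.zero)) (inj₁ Fin.zero)           s≢t e = contradiction e b≉0
    clash (inj₁ (Fin.suc Fin.zero)) (inj₁ (Fin.suc Fin.zero)) s≢t e = contradiction refl s≢t
    clash (inj₁ (Fin.suc Fin.zero)) (inj₂ (inj₁ k))           s≢t e = contradiction (root k , ≈-sym e) ¬□b
    clash (inj₁ (Fin.suc Fin.zero)) (inj₂ (inj₂ k))           s≢t e = found k (≈-sym e)
    clash (inj₂ (inj₁ k))           (inj₁ Fin.zero)           s≢t e = contradiction e (□≉0 k)
    clash (inj₂ (inj₁ k))           (inj₁ (Fin.suc Fin.zero)) s≢t e = contradiction (root k , e) ¬□b
    clash (inj₂ (inj₁ k))           (inj₂ (inj₁ l))           s≢t e = contradiction (cong (inj₂ ∘ inj₁) (root-injective k l e)) s≢t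
    clash (inj₂ (inj₁ k))           (inj₂ (inj₂ l))           s≢t e = contradiction (≈-sym e) (a□≉□ l k)
    clash (inj₂ (inj₂ k))           (inj₁ Fin.zero)           s≢t e = contradiction e (*-≉0 a≉0 (□≉0 k))
    clash (inj₂ (inj₂ k))           (inj₁ (Fin.suc Fin.zero)) s≢t e = found k e
    clash (inj₂ (inj₂ k))           (inj₂ (inj₁ l))           s≢t e = contradiction e (a□≉□ k l)
    clash (inj₂ (inj₂ k))           (inj₂ (inj₂ l))           s≢t e = contradiction (cong (inj₂ ∘ inj₂) (root-injective k l (*-cancelˡ a≉0 e))) s≢t

-- Sums of elements with prescribed quadratic characters

data Class : Set where
  zero : Class
  unit : Sign → Class

infixr 7 _·_
_·_ : Sign → Class → Class
s · zero   = zero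
s · unit t = unit (s Sign.* t)

isUnit : Class → Bool
isUnit zero     = false
isUnit (unit _) = true

-- The possible sets of values of a sum of terms with prescribed quadratic
-- characters modulo p.
data Range : Set where
  none  : Range
  coset : Sign → Range
  units : Range
  full   : Range

-- A nonzero term weighted by arbitrary units contributes every unit. Added to a set with at least
-- two values this gives everything, because any target differs from one of the two.
unitStep : Range → Bool → Range
unitStep r        false = r
unitStep none     true  = units
unitStep _        true  = full

-- The first argument is the quadratic character of −1.
signStep : Sign → Range → Class → Range
signStep κ r         zero     = r
signStep κ none      (unit s) = coset s
-- All nonzero values occur in any case. Zero occurs exactly when an element of sign `s` can be the
-- negative of one of sign `t`, that is when `s` is `κ` times `t`.
signStep κ (coset t) (unit s) = meet (κ Sign.* (s Sign.* t))
  where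
  meet : Sign → Range
  meet Sign.+ = full
  meet Sign.- = units
signStep κ units     (unit s) = full
signStep κ full       (unit s) = full

containsZero : Range → Bool
containsZero none      = true
containsZero (coset _) = false
containsZero units     = false
containsZero full       = true

-- The quadratic character and sums of two elements of given signs

module QuadraticCharacter {p : ℕ} (p-prime : Prime p) (2<p : 2 ℕ.< p) where
  open Int using (_+_; _*_; _-_; -_)
  open OddPrimeField p-prime 2<p public

  private
    variable
      x y z u v w : ℤ
      s t r : Sign

  data HasSign : Sign → ℤ → Set where
    square    : x ≉ 0ℤ → Square x → HasSign Sign.+ x
    nonsquare : x ≉ 0ℤ → ¬ Square x → HasSign Sign.- x

  data HasClass : Class → ℤ → Set where
    zero : x ≈ 0ℤ → HasClass zero x
    unit : HasSign s x → HasClass (unit s) x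

  data HasUnit : Bool → ℤ → Set where
    zero : x ≈ 0ℤ → HasUnit false x
    unit : x ≉ 0ℤ → HasUnit true x

  nonzero : HasSign s x → x ≉ 0ℤ
  nonzero (square x≉0 _)    = x≉0
  nonzero (nonsquare x≉0 _) = x≉0

  ≉0-resp : x ≈ y → x ≉ 0ℤ → y ≉ 0ℤ
  ≉0-resp x≈y x≉0 y≈0 = x≉0 (≈-trans x≈y y≈0)

  sign-resp : x ≈ y → HasSign s x → HasSign s y
  sign-resp e (square x≉0 □)     = square (≉0-resp e x≉0) (square-resp e □)
  sign-resp e (nonsquare x≉0 ¬□) = nonsquare (≉0-resp e x≉0) (¬□ ∘ square-resp (≈-sym e))

  class-resp : ∀ {c} → x ≈ y → HasClass c x → HasClass c y
  class-resp e (zero x≈0) = zero (≈-trans (≈-sym e) x≈0)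
  class-resp e (unit h)   = unit (sign-resp e h)

  sign-unique : HasSign s x → HasSign t x → s ≡ t
  sign-unique (square _ _)     (square _ _)     = refl
  sign-unique (square _ □)     (nonsquare _ ¬□) = contradiction □ ¬□
  sign-unique (nonsquare _ ¬□) (square _ □)     = contradiction □ ¬□
  sign-unique (nonsquare _ _)  (nonsquare _ _)  = refl

  class-unique : ∀ {c d} → HasClass c x → HasClass d x → c ≡ d
  class-unique (zero _)   (zero _)   = refl
  class-unique (zero x≈0) (unit h)   = contradiction x≈0 (nonzero h)
  class-unique (unit h)   (zero x≈0) = contradiction x≈0 (nonzero h)
  class-unique (unit h)   (unit k)   = cong unit (sign-unique h k)

  abstract
    sign-of : x ≉ 0ℤ → ∃[ s ] HasSign s x
    sign-of {x} x≉0 with square? x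
    ... | yes □ = Sign.+ , square x≉0 □
    ... | no ¬□ = Sign.- , nonsquare x≉0 ¬□

    class-of : ∀ x → ∃[ c ] HasClass c x
    class-of x with x ≈? 0ℤ
    ... | yes x≈0 = zero , zero x≈0
    ... | no x≉0 with s , h ← sign-of x≉0 = unit s , unit h

  sign-* : HasSign s x → HasSign t y → HasSign (s Sign.* t) (x * y)
  sign-* (square x≉0 □x) (square y≉0 □y) = square (*-≉0 x≉0 y≉0) (square-* □x □y)
  sign-* {x = x} {y = y} (square x≉0 □x) (nonsquare y≉0 ¬□y) = nonsquare (*-≉0 x≉0 y≉0)
    (¬□y ∘ square-quotient x≉0 □x ∘ square-resp (≈-reflexive (ℤₚ.*-comm x y)))
  sign-* (nonsquare x≉0 ¬□x) (square y≉0 □y) = nonsquare (*-≉0 x≉0 y≉0)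
    (¬□x ∘ square-quotient y≉0 □y)
  sign-* (nonsquare x≉0 ¬□x) (nonsquare y≉0 ¬□y) =
    square (*-≉0 x≉0 y≉0) (nonsquare-* x≉0 ¬□x y≉0 ¬□y)

  square-of : x ≉ 0ℤ → HasSign Sign.+ (x * x)
  square-of {x} x≉0 = square (*-≉0 x≉0 x≉0) (x , ≈-refl)

  sign-1 : HasSign Sign.+ 1ℤ
  sign-1 = square-of 1≉0

  sign-inverse : HasSign s x → x * y ≈ 1ℤ → HasSign s y
  sign-inverse {s} {x} {y} hx e =
    let r , hy = sign-of (*≈1⇒≉0 {y} {x} (≈-trans (≈-reflexive (ℤₚ.*-comm y x)) e))
        s*r≡r*r = trans (sign-unique (sign-resp e (sign-* hx hy)) sign-1) (sym (Signₚ.s*s≡+ r))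
    in subst (λ r → HasSign r y) (sym (Signₚ.*-cancelʳ-≡ r s r s*r≡r*r)) hy

  sign-divide : HasSign s x → HasSign t y → ∃[ u ] HasSign (s Sign.* t) u × u * x ≈ y
  sign-divide {s} {x} {t} {y} hx hy =
    let i , xi≈1 = inverse (nonzero hx) in
    y * i , subst (λ r → HasSign r (y * i)) (Signₚ.*-comm t s) (sign-* hy (sign-inverse hx xi≈1)) , cancel xi≈1
    where
    open ≈-Reasoning
    cancel : ∀ {i} → x * i ≈ 1ℤ → y * i * x ≈ y
    cancel {i} xi≈1 = begin
      y * i * x   ≡⟨ lemma y i x ⟩
      y * (x * i) ≈⟨ *-congˡ y xi≈1 ⟩
      y * 1ℤ      ≡⟨ ℤₚ.*-identityʳ y ⟩
      y           ∎
      where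
      lemma : ∀ y i x → y * i * x ≡ y * (x * i)
      lemma = solve-∀

  abstract
    representative : ∀ s → ∃[ x ] HasSign s x
    representative Sign.+ = 1ℤ , sign-1
    representative Sign.- with a , a≉0 , ¬□a ← ∃-nonsquare = a , nonsquare a≉0 ¬□a

    -1-sign : ∃[ κ ] HasSign κ -1ℤ
    -1-sign = sign-of (λ e → 1≉0 (-‿cong e))

  κ : Sign
  κ = proj₁ -1-sign

  sign-neg : HasSign s x → HasSign (κ Sign.* s) (- x)
  sign-neg {x = x} h = sign-resp (≈-reflexive (lemma x)) (sign-* (proj₂ -1-sign) h)
    where
    lemma : ∀ x → -1ℤ * x ≡ - x
    lemma = ℤₚ.-1*i≡-i

  class-* : ∀ {c} → HasSign s u → HasClass c x → HasClass (s · c) (u * x)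
  class-* {u = u} h (zero x≈0) = zero (zeroʳ u x≈0)
  class-* h (unit k)   = unit (sign-* h k)

  -- Turns a value of the right class back into a weight of the prescribed sign. A zero term leaves
  -- the weight free, so any representative of the sign serves; a unit term forces the quotient v /
  -- x.
  class-divide : ∀ s {c} → HasClass c x → HasClass (s · c) v → ∃[ u ] HasSign s u × u * x ≈ v
  class-divide s (zero x≈0) (zero v≈0) =
    let u , h = representative s in u , h , ≈-trans (zeroʳ u x≈0) (≈-sym v≈0)
  class-divide s (unit {t} h) (unit k) =
    let u , hu , e = sign-divide h k in u , subst (λ r → HasSign r u) (cancel t s) hu , e
    where
    cancel : ∀ t s → t Sign.* (s Sign.* t) ≡ s
    cancel Sign.+ Sign.+ = refl
    cancel Sign.+ Sign.- = refl
    cancel Sign.- Sign.+ = refl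
    cancel Sign.- Sign.- = refl

  unit-* : ∀ {b} → u ≉ 0ℤ → HasUnit b x → HasUnit b (u * x)
  unit-* {u = u} u≉0 (zero x≈0) = zero (zeroʳ u x≈0)
  unit-* u≉0 (unit x≉0) = unit (*-≉0 u≉0 x≉0)

  unit-divide : ∀ {b} → HasUnit b x → HasUnit b v → ∃[ u ] u ≉ 0ℤ × u * x ≈ v
  unit-divide (zero x≈0) (zero v≈0) = 1ℤ , 1≉0 , ≈-trans (zeroʳ 1ℤ x≈0) (≈-sym v≈0)
  unit-divide (unit x≉0) (unit v≉0) =
    let _ , h = sign-of x≉0
        _ , k = sign-of v≉0
        u , hu , e = sign-divide h k
    in u , nonzero hu , e

  Sum : Sign → Sign → Sign → Set
  Sum s t r = ∃₂ λ x y → HasSign s x × HasSign t y × HasSign r (x + y)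

  sum-scale : ∀ w → Sum s t r → Sum (w Sign.* s) (w Sign.* t) (w Sign.* r)
  sum-scale w (x , y , hx , hy , hz) =
    let c , hc = representative w in
    c * x , c * y , sign-* hc hx , sign-* hc hy ,
    sign-resp (≈-reflexive (ℤₚ.*-distribˡ-+ c x y)) (sign-* hc hz)

  sum-swap : Sum s t r → Sum t s r
  sum-swap (x , y , hx , hy , hz) = y , x , hy , hx , sign-resp (≈-reflexive (ℤₚ.+-comm x y)) hz

  -- One solution yields all: two elements of the same sign differ by a square factor, and scaling
  -- by it preserves the signs of both summands.
  sum-target : Sum s t r → HasSign r w → ∃[ v ] HasSign s v × HasSign t (w - v)
  sum-target {s} {t} {r} {w} (x , y , hx , hy , hz) hw = result (sign-divide hz hw)
    where
    lemma : ∀ u x y → u * y ≡ u * (x + y) - u * x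
    lemma = solve-∀
    result : (∃[ u ] HasSign (r Sign.* r) u × u * (x + y) ≈ w) → ∃[ v ] HasSign s v × HasSign t (w - v)
    result (u , hu , e) = u * x , sign-* hu′ hx ,
      sign-resp (≈-trans (≈-reflexive (lemma u x y)) (+-cong e (≈-refl { - (u * x)}))) (sign-* hu′ hy)
      where
      hu′ : HasSign Sign.+ u
      hu′ = subst (λ r → HasSign r u) (Signₚ.s*s≡+ r) hu

  infix 4 _∈ᴿ_
  _∈ᴿ_ : ℤ → Range → Set
  x ∈ᴿ none    = x ≈ 0ℤ
  x ∈ᴿ coset s = HasSign s x
  x ∈ᴿ units   = x ≉ 0ℤ
  x ∈ᴿ full     = ⊤

  range-resp : ∀ r → x ≈ y → x ∈ᴿ r → y ∈ᴿ r
  range-resp none      e x≈0 = ≈-trans (≈-sym e) x≈0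
  range-resp (coset s) e h   = sign-resp e h
  range-resp units     e x≉0 = ≉0-resp e x≉0
  range-resp full       e _   = tt

  containsZero⇒ : ∀ r → T (containsZero r) → x ≈ 0ℤ → x ∈ᴿ r
  containsZero⇒ none _ x≈0 = x≈0
  containsZero⇒ full  _ _   = tt

  ⇒containsZero : ∀ r → x ∈ᴿ r → x ≈ 0ℤ → T (containsZero r)
  ⇒containsZero none      _   _   = tt
  ⇒containsZero (coset s) h   x≈0 = contradiction x≈0 (nonzero h)
  ⇒containsZero units     x≉0 x≈0 = contradiction x≈0 x≉0
  ⇒containsZero full       _   _   = tt

  -- The bound makes 3, 4 and 5 nonzero modulo p, so that 9, 16 and 25 are nonzero squares.
  module _ (5<p : 5 ℕ.< p) where

    private
      small : ∀ k → suc k ℕ.≤ 5 → HasSign Sign.+ (+ suc k * + suc k)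
      small k k<5 = square-of (≉0-small (s≤s z≤n) (ℕₚ.≤-<-trans k<5 5<p))

      nine    = small 2 (s≤s (s≤s (s≤s z≤n)))
      sixteen = small 3 (s≤s (s≤s (s≤s (s≤s z≤n))))
      twenty-five = small 4 (s≤s (s≤s (s≤s (s≤s (s≤s z≤n)))))

    -- 3² + 4² = 5²
    sum+++ : Sum Sign.+ Sign.+ Sign.+
    sum+++ = + 9 , + 16 , nine , sixteen , twenty-five

    -- The least positive nonsquare N is the sum of the squares N − 1 and 1.
    sum++- : Sum Sign.+ Sign.+ Sign.-
    sum++- with a , h ← representative Sign.- = search (residue p a) (sign-resp (≈-sym (residue-≈ p a)) h)
      where
      instance _ = prime⇒nonZero p-prime
      -- The walk is not confined to k < p, so a multiple of p has to be allowed; its successor is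
      -- congruent to 1 and hence a square. The first step from a square to a nonsquare gives the
      -- sum.
      ascend : ∀ k → Sum Sign.+ Sign.+ Sign.- ⊎ (+ k ≈ 0ℤ ⊎ HasSign Sign.+ (+ k))
      ascend zero = inj₂ (inj₁ ≈-refl)
      ascend (suc k) with ascend k
      ... | inj₁ found = inj₁ found
      ... | inj₂ (inj₁ k≈0) = inj₂ (inj₂ (sign-resp (+-cong {1ℤ} {1ℤ} ≈-refl (≈-sym k≈0)) sign-1))
      ... | inj₂ (inj₂ h) with class-of (+ suc k)
      ...   | zero , zero e = inj₂ (inj₁ e)
      ...   | unit Sign.+ , unit h′ = inj₂ (inj₂ h′)
      ...   | unit Sign.- , unit h′ = inj₁ (1ℤ , + k , sign-1 , h , h′)
      search : ∀ i → HasSign Sign.- (+ toℕ {p} i) → Sum Sign.+ Sign.+ Sign.-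
      search i h with ascend (toℕ i)
      ... | inj₁ found = found
      ... | inj₂ (inj₁ e) = contradiction e (nonzero h)
      ... | inj₂ (inj₂ h′) with () ← sign-unique h h′

    sum-+-+ : Sum Sign.- Sign.+ Sign.+
    sum-+-+ = by-sign κ refl
      where
      by-sign : ∀ k → κ ≡ k → Sum Sign.- Sign.+ Sign.+
      -- If -1 is a square, a summand of the previous representation can be moved to the other side
      -- without changing its sign.
      by-sign Sign.+ e = let x , y , hx , hy , hz = sum++- in
        x + y , - y , hz , subst (λ k → HasSign (k Sign.* Sign.+) (- y)) e (sign-neg hy) ,
        sign-resp (≈-reflexive (lemma x y)) hx
        where
        lemma : ∀ x y → x ≡ (x + y) + - y
        lemma = solve-∀
      -- If -1 is a nonsquare, so is -16, and -16 + 25 = 9.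
      by-sign Sign.- e = - (+ 16) , + 25 , subst (λ k → HasSign (k Sign.* Sign.+) (- (+ 16))) e (sign-neg sixteen) ,
        twenty-five , nine

    -- Exchanging the summands and multiplying by a nonsquare, which flips all three signs, reduce
    -- the eight patterns to three.
    sum : ∀ s t r → Sum s t r
    sum Sign.+ Sign.+ Sign.+ = sum+++
    sum Sign.+ Sign.+ Sign.- = sum++-
    sum Sign.- Sign.+ Sign.+ = sum-+-+
    sum Sign.+ Sign.- Sign.+ = sum-swap sum-+-+
    sum Sign.- Sign.- Sign.- = sum-scale Sign.- sum+++
    sum Sign.- Sign.- Sign.+ = sum-scale Sign.- sum++-
    sum Sign.+ Sign.- Sign.- = sum-scale Sign.- sum-+-+
    sum Sign.- Sign.+ Sign.- = sum-scale Sign.- (sum-swap sum-+-+)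

    split : ∀ s t → w ≉ 0ℤ → ∃[ v ] HasSign s v × HasSign t (w - v)
    split s t w≉0 = let r , h = sign-of w≉0 in sum-target (sum s t r) h

    avoid : ∀ s w → ∃[ v ] HasSign s v × w - v ≉ 0ℤ
    avoid s w with v , h ← representative s with w - v ≈? 0ℤ
    ... | no  w-v≉0 = v , h , w-v≉0
    -- The candidates v and 4 v have the same sign, and `w` can equal both only if 3 v vanishes.
    ... | yes w-v≈0 = + 4 * v , sign-* (small 1 (s≤s (s≤s z≤n))) h , λ e →
      *-≉0 (≉0-small {3} (s≤s z≤n) (ℕₚ.≤-trans (s≤s (s≤s (s≤s (s≤s z≤n)))) 5<p)) (nonzero h)
        (≈-trans (≈-reflexive (lemma w v)) (+-cong w-v≈0 (-‿cong e)))
      where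
      lemma : ∀ w v → + 3 * v ≡ (w - v) + - (w - + 4 * v)
      lemma = solve-∀

    private
      +-0 : y ≈ 0ℤ → x ≈ x + y
      +-0 {y} {x} e = ≈-trans (≈-reflexive (sym (ℤₚ.+-identityʳ x))) (+-cong (≈-refl {x}) (≈-sym e))

      0-+ : y ≈ 0ℤ → x ≈ y + x
      0-+ {y} {x} e = ≈-trans (+-0 e) (≈-reflexive (ℤₚ.+-comm x y))

      x≈x-0 : ∀ x → x ≈ x - 0ℤ
      x≈x-0 x = ≈-reflexive (sym (ℤₚ.+-identityʳ x))

      x-x : ∀ x → x - x ≈ 0ℤ
      x-x x = ≈-reflexive (ℤₚ.+-inverseʳ x)

      sub-sub : ∀ x y → y ≈ x - (x - y)
      sub-sub x y = ≈-reflexive (lemma x y)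
        where
        lemma : ∀ x y → y ≡ x - (x - y)
        lemma = solve-∀

    signStep-sound : ∀ r {c} → x ∈ᴿ r → HasClass c y → x + y ∈ᴿ signStep κ r c
    signStep-sound r         h   (zero y≈0)    = range-resp r (+-0 y≈0) h
    signStep-sound none      x≈0 (unit k)      = sign-resp (0-+ x≈0) k
    signStep-sound {x} {y} (coset t) h (unit {s} k) with κ Sign.* (s Sign.* t) in eq
    ... | Sign.+ = tt
    ... | Sign.- = λ x+y≈0 → +≢- (trans (sym (trans (cong (λ r → κ Sign.* (r Sign.* t)) (s≡κt x+y≈0)) (cancel κ t))) eq)
      where
      +≢- : Sign.+ ≢ Sign.-
      +≢- ()
      cancel : ∀ κ t → κ Sign.* ((κ Sign.* t) Sign.* t) ≡ Sign.+
      cancel Sign.+ Sign.+ = refl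
      cancel Sign.+ Sign.- = refl
      cancel Sign.- Sign.+ = refl
      cancel Sign.- Sign.- = refl
      lemma : ∀ x y → y ≡ (x + y) + - x
      lemma = solve-∀
      s≡κt : x + y ≈ 0ℤ → s ≡ κ Sign.* t
      s≡κt e = sign-unique (sign-resp (≈-trans (≈-reflexive (lemma x y)) (≈-trans (+-cong e (≈-refl { - x})) (≈-reflexive (ℤₚ.+-identityˡ (- x))))) k) (sign-neg h)
    signStep-sound units     _ (unit _) = tt
    signStep-sound full       _ (unit _) = tt

    signStep-complete : ∀ r c → x ∈ᴿ signStep κ r c → ∃[ v ] HasClass c v × x - v ∈ᴿ r
    signStep-complete {x} r zero h = 0ℤ , zero ≈-refl , range-resp r (x≈x-0 x) h
    signStep-complete {x} none (unit s) h = x , unit h , x-x x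
    signStep-complete {x} (coset t) (unit s) h with κ Sign.* (s Sign.* t) in eq
    ... | Sign.- = let v , hv , hw = split s t h in v , unit hv , hw
    ... | Sign.+ with x ≈? 0ℤ
    ...   | no x≉0 = let v , hv , hw = split s t x≉0 in v , unit hv , hw
    -- Zero is out of reach of `split`, but it is v + (-v), and the equation for the signs says that
    -- -v lies in the coset of `t`.
    ...   | yes x≈0 = let v , hv = representative s in
      v , unit hv , sign-resp (0-+ {x} { - v} x≈0) (subst (λ r → HasSign r (- v)) (cancel κ s t eq) (sign-neg hv))
      where
      cancel : ∀ κ s t → κ Sign.* (s Sign.* t) ≡ Sign.+ → κ Sign.* s ≡ t
      cancel Sign.+ Sign.+ Sign.+ _ = refl
      cancel Sign.+ Sign.- Sign.- _ = refl
      cancel Sign.- Sign.+ Sign.- _ = refl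
      cancel Sign.- Sign.- Sign.+ _ = refl
    signStep-complete {x} units (unit s) _ = let v , hv , hw = avoid s x in v , unit hv , hw
    signStep-complete full (unit s) _ = let v , hv = representative s in v , unit hv , tt

    unitStep-sound : ∀ r {b} → x ∈ᴿ r → HasUnit b y → x + y ∈ᴿ unitStep r b
    unitStep-sound r         h   (zero y≈0) = range-resp r (+-0 y≈0) h
    unitStep-sound none      x≈0 (unit y≉0) = ≉0-resp (0-+ x≈0) y≉0
    unitStep-sound (coset _) _   (unit _)   = tt
    unitStep-sound units     _   (unit _)   = tt
    unitStep-sound full       _   (unit _)   = tt

    unitStep-complete : ∀ r b → x ∈ᴿ unitStep r b → ∃[ v ] HasUnit b v × x - v ∈ᴿ r
    unitStep-complete {x} r false h = 0ℤ , zero ≈-refl , range-resp r (x≈x-0 x) h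
    unitStep-complete {x} none true h = x , unit h , x-x x
    -- The roles are exchanged here: `avoid` chooses the part that lies in the old range, and the
    -- nonzero remainder is what the new term contributes.
    unitStep-complete {x} (coset s) true _ = let v , hv , hw = avoid s x in x - v , unit hw , sign-resp (sub-sub x v) hv
    unitStep-complete {x} units true _ = let v , hv , hw = avoid Sign.+ x in x - v , unit hw , ≉0-resp (sub-sub x v) (nonzero hv)
    unitStep-complete {x} full true _ = let v , hv , hw = avoid Sign.+ x in x - v , unit hw , tt

-- Automata deciding the existence of weighted zero-sum subsequences

∣⇒≈ : ∀ {m n x y} → m ℕ∣.∣ n → Congruence._≈_ (+ n) x y → Congruence._≈_ (+ m) x y
∣⇒≈ m∣n (Congruence.congruent d) = Congruence.congruent (ℤ∣.∣-trans (ℤ∣.∣ᵤ⇒∣ m∣n) d)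

coprime-≈ : ∀ {m n k x y} → Coprime m n → k ≡ m ℕ.* n → Congruence._≈_ (+ m) x y → Congruence._≈_ (+ n) x y →
            Congruence._≈_ (+ k) x y
coprime-≈ {m} {n} c refl (Congruence.congruent d) (Congruence.congruent e) =
  Congruence.congruent (ℤ∣.∣ᵤ⇒∣ (product-∣ (ℤ∣.∣⇒∣ᵤ d) (ℤ∣.∣⇒∣ᵤ e)))
  where
  product-∣ : ∀ {k} → m ℕ∣.∣ k → n ℕ∣.∣ k → m ℕ.* n ℕ∣.∣ k
  product-∣ m∣k (ℕ∣.divides q refl) =
    ℕ∣.*-monoˡ-∣ n (coprime-divisor c (subst (m ℕ∣.∣_) (ℕₚ.*-comm q n) m∣k))

-- Subsequence, weights and sum in one derivation that follows the list, as an automaton reads it.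
-- The Boolean index tells whether some term has been selected.
data Selection (A : ℤ → Set) : Bool → List ℤ → ℤ → Set where
  []   : Selection A false [] 0ℤ
  skip : ∀ {b x xs s} → Selection A b xs s → Selection A b (x ∷ xs) s
  weigh : ∀ {b u x xs s} → A u → Selection A b xs s → Selection A true (x ∷ xs) (u Int.* x Int.+ s)

ZeroSum : ℕ → (ℤ → Set) → List ℤ → Set
ZeroSum m A xs = ∃[ s ] Selection A true xs s × Congruence._≈_ (+ m) s 0ℤ

-- The index is the sum as it is bracketed by the list, so exchanging two selected terms changes it
-- into an equal but different expression; hence the equation in the conclusion.
selection-↭ : ∀ {A b xs ys s} → xs ↭ ys → Selection A b xs s → ∃[ t ] t ≡ s × Selection A b ys t
selection-↭ Perm.refl σ = _ , refl , σ
selection-↭ (Perm.prep x π) (skip σ) with _ , refl , τ ← selection-↭ π σ = _ , refl , skip τ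
selection-↭ (Perm.prep x π) (weigh a σ) with _ , refl , τ ← selection-↭ π σ = _ , refl , weigh a τ
selection-↭ (Perm.swap x y π) (skip (skip σ)) with _ , refl , τ ← selection-↭ π σ = _ , refl , skip (skip τ)
selection-↭ (Perm.swap x y π) (skip (weigh a σ)) with _ , refl , τ ← selection-↭ π σ = _ , refl , weigh a (skip τ)
selection-↭ (Perm.swap x y π) (weigh a (skip σ)) with _ , refl , τ ← selection-↭ π σ = _ , refl , skip (weigh a τ)
selection-↭ (Perm.swap x y π) (weigh {u = u} a (weigh {u = v} {s = s} b σ)) with _ , refl , τ ← selection-↭ π σ =
  _ , lemma (u Int.* x) (v Int.* y) s , weigh b (weigh a τ)
  where
  open Int using (_+_)
  lemma : ∀ a b s → b + (a + s) ≡ a + (b + s)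
  lemma = solve-∀
selection-↭ (Perm.trans π ρ) σ with _ , refl , τ ← selection-↭ π σ = selection-↭ ρ τ

zeroSum-↭ : ∀ {m A xs ys} → xs ↭ ys → ZeroSum m A xs → ZeroSum m A ys
zeroSum-↭ π (s , σ , e) with _ , refl , τ ← selection-↭ π σ = s , τ , e

record Automaton : Set₁ where
  field
    State Letter : Set
    start  : State
    next   : State → Letter → List State
    accept : State → Bool

  -- The Boolean records whether a term has been selected already, since the
  -- empty subsequence does not count.
  search : Bool → State → List Letter → Bool
  search b s []       = b ∧ accept s
  search b s (x ∷ xs) = search b s xs ∨ any (λ t → search true t xs) (next s x)

  accepts : List Letter → Bool
  accepts = search false start

  search-skip : ∀ b s x xs → T (search b s xs) → T (search b s (x ∷ xs))
  search-skip b s x xs h = from (T-∨ {search b s xs}) (inj₁ h)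

  search-read : ∀ b s x xs {t} → t ∈ next s x → T (search true t xs) → T (search b s (x ∷ xs))
  search-read b s x xs t∈ h = from (T-∨ {search b s xs}) (inj₂ (any⁺ _ (lose t∈ h)))


infixr 5 _⊗_
-- A letter is skipped or read in both components at once, so the two zero sums concern the same
-- subsequence, while the transitions, and with them the weights, are chosen independently.
_⊗_ : Automaton → Automaton → Automaton
M ⊗ N = record
  { State  = M.State × N.State
  ; Letter = M.Letter × N.Letter
  ; start  = M.start , N.start
  ; next   = λ (s , t) (x , y) → cartesianProduct (M.next s x) (N.next t y)
  ; accept = λ (s , t) → M.accept s ∧ N.accept t
  }
  where
  module M = Automaton M
  module N = Automaton N

-- A state stands for the set of values that the weighted sum of the letters
-- read so far can take, so that acceptance means that zero is such a value.
record Model (M : Automaton) (m : ℕ) (A : ℤ → Set) : Set₁ where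
  open Automaton M
  open Congruence (+ m)
  open Int using (_+_; _*_; _-_; -_)
  infix 4 _∈ₛ_
  field
    letter      : ℤ → Automaton.Letter M
    weight-resp : ∀ {u v} → u ≈ v → A u → A v
    _∈ₛ_        : ℤ → Automaton.State M → Set
    resp        : ∀ {s x y} → x ≈ y → x ∈ₛ s → y ∈ₛ s
    start⇒      : ∀ {x} → x ∈ₛ start → x ≈ 0ℤ
    ⇒start      : ∀ {x} → x ≈ 0ℤ → x ∈ₛ start
    accept⇒     : ∀ {s x} → T (accept s) → x ≈ 0ℤ → x ∈ₛ s
    ⇒accept     : ∀ {s x} → x ∈ₛ s → x ≈ 0ℤ → T (accept s)
    forward     : ∀ {u s x y} → A u → x ∈ₛ s → ∃[ t ] t ∈ next s (letter y) × x + u * y ∈ₛ t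
    backward    : ∀ {s t x y} → t ∈ next s (letter y) → x ∈ₛ t → ∃[ u ] A u × x - u * y ∈ₛ s

  -- Here `y` is a value attained on the part already read and `x` the weighted sum of the rest, and
  -- the two cancel. The weights are recovered from the end: an accepting state contains zero, and
  -- `backward` then removes one selected term at a time.
  search⇒selection : ∀ b s xs → T (search b s (map letter xs)) →
    ∃₂ λ c x → ∃[ y ] Selection A c xs x × T (b ∨ c) × y ∈ₛ s × y + x ≈ 0ℤ
  search⇒selection true s [] h = false , 0ℤ , 0ℤ , [] , tt , accept⇒ h ≈-refl , ≈-refl
  search⇒selection b s (z ∷ zs) h with to (T-∨ {search b s (map letter zs)}) h
  ... | inj₁ h′ =
    let c , x , y , σ , bc , hy , e = search⇒selection b s zs h′
    in c , x , y , skip σ , bc , hy , e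
  ... | inj₂ h′ =
    let t , t∈ , ht = find (any⁻ _ (next s (letter z)) h′)
        c , x , y , σ , _ , hy , e = search⇒selection true t zs ht
        u , a , hy′ = backward t∈ hy
    in true , u * z + x , y - u * z , weigh a σ , from (T-∨ {b}) (inj₂ tt) , hy′ ,
       ≈-trans (≈-reflexive (lemma y (u * z) x)) e
    where
    lemma : ∀ y v x → (y - v) + (v + x) ≡ y + x
    lemma = solve-∀

  selection⇒search : ∀ {b s c xs x y} → Selection A c xs x → T (b ∨ c) → y ∈ₛ s → y + x ≈ 0ℤ →
    T (search b s (map letter xs))
  selection⇒search {true} {s} {y = y} [] _ hy e =
    ⇒accept hy (≈-trans (≈-reflexive (sym (ℤₚ.+-identityʳ y))) e)
  selection⇒search {b} {s} {xs = z ∷ zs} (skip σ) bc hy e =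
    search-skip b s (letter z) (map letter zs) (selection⇒search σ bc hy e)
  selection⇒search {b} {s} {y = y} (weigh {b = c} {u = u} {x = z} {xs = zs} {s = x} a σ) bc hy e =
    let t , t∈ , hy′ = forward {y = z} a hy
        ht = selection⇒search {true} {t} {c} σ tt hy′ (≈-trans (≈-reflexive (ℤₚ.+-assoc y (u * z) x)) e)
    in search-read b s (letter z) (map letter zs) t∈ ht

  accepts⇔zeroSum : ∀ {xs} → T (accepts (map letter xs)) ⇔ ZeroSum m A xs
  accepts⇔zeroSum {xs} = mk⇔ forth back
    where
    forth : T (accepts (map letter xs)) → ZeroSum m A xs
    forth h with search⇒selection false start xs h
    ... | true , x , y , σ , _ , hy , e =
      x , σ , ≈-trans (≈-reflexive (lemma y x)) (≈-trans (+-cong e (-‿cong (start⇒ hy))) ≈-refl)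
      where
      lemma : ∀ y x → x ≡ (y + x) + - y
      lemma = solve-∀
    back : ZeroSum m A xs → T (accepts (map letter xs))
    back (x , σ , e) = selection⇒search σ tt (⇒start ≈-refl)
      (≈-trans (≈-reflexive (ℤₚ.+-identityˡ x)) e)

-- The weights supplied by the two components are merged by the Chinese remainder theorem; the
-- merged weight is only congruent to each of them, which is why a model asks for `weight-resp`.
product-model : ∀ {M N m n k A B} → Coprime m n → k ≡ m ℕ.* n →
  Model M m A → Model N n B → Model (M ⊗ N) k (λ u → A u × B u)
product-model {M} {N} {m} {n} {k} {A} {B} c k≡mn 𝓜 𝓝 = record
  { letter      = λ x → M.letter x , N.letter x
  ; weight-resp = λ e (a , b) → M.weight-resp (≈m e) a , N.weight-resp (≈n e) b
  ; _∈ₛ_        = λ x (s , t) → x M.∈ₛ s × x N.∈ₛ t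
  ; resp        = λ e (h , k) → M.resp (≈m e) h , N.resp (≈n e) k
  ; start⇒      = λ (h , k) → coprime-≈ c k≡mn (M.start⇒ h) (N.start⇒ k)
  ; ⇒start      = λ e → M.⇒start (≈m e) , N.⇒start (≈n e)
  ; accept⇒     = λ ac e → let a , b = to T-∧ ac in M.accept⇒ a (≈m e) , N.accept⇒ b (≈n e)
  ; ⇒accept     = λ (h , k) e → from T-∧ (M.⇒accept h (≈m e) , N.⇒accept k (≈n e))
  ; forward     = λ (a , b) (h , k) →
      let s , s∈ , h′ = M.forward a h
          t , t∈ , k′ = N.forward b k
      in (s , t) , ∈-cartesianProduct⁺ s∈ t∈ , h′ , k′
  ; backward    = λ {s} {t} {x} {y} → back {s} {t} {x} {y}
  }
  where
  module M = Model 𝓜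
  module N = Model 𝓝
  open Int using (_+_; _*_; _-_; -_)
  module Cm = Congruence (+ m)
  module Cn = Congruence (+ n)
  ≈m : ∀ {x y} → Congruence._≈_ (+ k) x y → x Cm.≈ y
  ≈m = ∣⇒≈ (subst (m ℕ∣.∣_) (sym k≡mn) (ℕ∣.m∣m*n n))
  ≈n : ∀ {x y} → Congruence._≈_ (+ k) x y → x Cn.≈ y
  ≈n = ∣⇒≈ (subst (n ℕ∣.∣_) (sym k≡mn) (ℕ∣.n∣m*n m))
  back : ∀ {s t x y} →
    t ∈ cartesianProduct (Automaton.next M (proj₁ s) (M.letter y)) (Automaton.next N (proj₂ s) (N.letter y)) →
    (x M.∈ₛ proj₁ t) × (x N.∈ₛ proj₂ t) →
    ∃[ u ] (A u × B u) × (x - u * y M.∈ₛ proj₁ s) × (x - u * y N.∈ₛ proj₂ s)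
  back {s} {t} {x} {y} t∈ (h , k) =
    let t∈₁ , t∈₂ = ∈-cartesianProduct⁻ _ _ t∈
        u₁ , a , h′ = M.backward t∈₁ h
        u₂ , b , k′ = N.backward t∈₂ k
        u , e₁ , e₂ = chinese-remainder c u₁ u₂
    in u , (M.weight-resp (Cm.≈-sym e₁) a , N.weight-resp (Cn.≈-sym e₂) b) ,
       M.resp (Cm.+-cong (Cm.≈-refl {x}) (Cm.-‿cong (Cm.*-congʳ y (Cm.≈-sym e₁)))) h′ ,
       N.resp (Cn.+-cong (Cn.≈-refl {x}) (Cn.-‿cong (Cn.*-congʳ y (Cn.≈-sym e₂)))) k′

-- Models for unit weights and for weights of equal signs modulo two primes

unitAutomaton : Automaton
unitAutomaton = record
  { State  = Range
  ; Letter = Bool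
  ; start  = none
  ; next   = λ r b → unitStep r b ∷ []
  ; accept = containsZero
  }

-- Pairs of classes up to simultaneous change of sign.
data ClassPair : Set where
  neither left right : ClassPair
  both : Sign → ClassPair

fst snd : ClassPair → Class
fst neither  = zero
fst left     = unit Sign.+
fst right    = zero
fst (both _) = unit Sign.+
snd neither  = zero
snd left     = zero
snd right    = unit Sign.+
snd (both s) = unit s

classPair : Class → Class → ClassPair
classPair zero     zero     = neither
classPair (unit _) zero     = left
classPair zero     (unit _) = right
classPair (unit s) (unit t) = both (s Sign.* t)

-- The sign that makes the first nonzero class of a pair positive, which is the convention built
-- into `fst` and `snd`.
normaliser : Class → Class → Sign
normaliser zero     zero     = Sign.+
normaliser (unit s) _        = s
normaliser zero     (unit t) = t

·-assoc : ∀ s t c → (s Sign.* t) · c ≡ s · t · c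
·-assoc s t zero     = refl
·-assoc s t (unit r) = cong unit (Signₚ.*-assoc s t r)

normalise-fst : ∀ c d → normaliser c d · c ≡ fst (classPair c d)
normalise-fst zero     zero     = refl
normalise-fst (unit s) zero     = cong unit (Signₚ.s*s≡+ s)
normalise-fst zero     (unit t) = refl
normalise-fst (unit s) (unit t) = cong unit (Signₚ.s*s≡+ s)

normalise-snd : ∀ c d → normaliser c d · d ≡ snd (classPair c d)
normalise-snd zero     zero     = refl
normalise-snd (unit s) zero     = refl
normalise-snd zero     (unit t) = cong unit (Signₚ.s*s≡+ t)
normalise-snd (unit s) (unit t) = refl

signs : List Sign
signs = Sign.+ ∷ Sign.- ∷ []

∈-signs : ∀ s → s ∈ signs
∈-signs Sign.+ = here refl
∈-signs Sign.- = there (here refl)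

pairStep : Sign → Sign → Range × Range → ClassPair → Sign → Range × Range
pairStep κ₁ κ₂ (r₁ , r₂) c s = signStep κ₁ r₁ (s · fst c) , signStep κ₂ r₂ (s · snd c)

-- Once the common sign of a weight is fixed, the two primes are independent, so each sign gets its
-- own transition. As both signs are offered, letters matter only up to a simultaneous change of
-- sign.
pairAutomaton : Sign → Sign → Automaton
pairAutomaton κ₁ κ₂ = record
  { State  = Range × Range
  ; Letter = ClassPair
  ; start  = none , none
  ; next   = λ r c → map (pairStep κ₁ κ₂ r c) signs
  ; accept = λ (r₁ , r₂) → containsZero r₁ ∧ containsZero r₂
  }

module UnitModel {p : ℕ} (p-prime : Prime p) (2<p : 2 ℕ.< p) (5<p : 5 ℕ.< p) where
  open QuadraticCharacter p-prime 2<p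
  open Int using (_+_; _*_; _-_; -_)

  unitLetter : ℤ → Bool
  unitLetter x = isUnit (proj₁ (class-of x))

  hasUnit : ∀ x → HasUnit (unitLetter x) x
  hasUnit x with class-of x
  ... | zero   , zero x≈0 = zero x≈0
  ... | unit _ , unit h   = unit (nonzero h)

  unit-model : Model unitAutomaton p (_≉ 0ℤ)
  unit-model = record
    { letter      = unitLetter
    ; weight-resp = ≉0-resp
    ; _∈ₛ_        = _∈ᴿ_
    ; resp        = λ {s} → range-resp s
    ; start⇒      = id
    ; ⇒start      = id
    ; accept⇒     = λ {s} → containsZero⇒ s
    ; ⇒accept     = λ {s} → ⇒containsZero s
    ; forward     = λ {u} {s} {x} {y} u≉0 h → _ , here refl , unitStep-sound 5<p s h (unit-* u≉0 (hasUnit y))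
    ; backward    = back
    }
    where
    back : ∀ {s t x y} → t ∈ unitStep s (unitLetter y) ∷ [] → x ∈ᴿ t → ∃[ u ] u ≉ 0ℤ × x - u * y ∈ᴿ s
    back {s} {x = x} {y} (here refl) h =
      let v , hv , hw = unitStep-complete 5<p s (unitLetter y) h
          u , u≉0 , e = unit-divide (hasUnit y) hv
      in u , u≉0 , range-resp s (+-cong (≈-refl {x}) (-‿cong (≈-sym e))) hw

module PairModel {p q : ℕ} (p-prime : Prime p) (2<p : 2 ℕ.< p) (5<p : 5 ℕ.< p)
                 (q-prime : Prime q) (2<q : 2 ℕ.< q) (5<q : 5 ℕ.< q) (p⊥q : Coprime p q) where
  open Int using (_+_; _*_; _-_; -_)
  module P = QuadraticCharacter p-prime 2<p
  module Q = QuadraticCharacter q-prime 2<q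

  SameSign : ℤ → Set
  SameSign u = ∃[ s ] P.HasSign s u × Q.HasSign s u

  pairLetter : ℤ → ClassPair
  pairLetter x = classPair (proj₁ (P.class-of x)) (proj₁ (Q.class-of x))

  private
    cancel : ∀ s t → (s Sign.* t) Sign.* t ≡ s
    cancel s t = trans (Signₚ.*-assoc s t t) (trans (cong (s Sign.*_) (Signₚ.s*s≡+ t)) (Signₚ.*-identityʳ s))

    move : ∀ s t c {d} → t · c ≡ d → s · c ≡ (s Sign.* t) · d
    move s t c refl = trans (cong (_· c) (sym (cancel s t))) (·-assoc (s Sign.* t) t c)

  pair-model : ∀ {k} → k ≡ p ℕ.* q → Model (pairAutomaton P.κ Q.κ) k SameSign
  pair-model {k} k≡pq = record
    { letter      = pairLetter
    ; weight-resp = λ e (s , h , k) → s , P.sign-resp (≈p e) h , Q.sign-resp (≈q e) k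
    ; _∈ₛ_        = λ x (r₁ , r₂) → x P.∈ᴿ r₁ × x Q.∈ᴿ r₂
    ; resp        = λ {(r₁ , r₂)} e (h , k) → P.range-resp r₁ (≈p e) h , Q.range-resp r₂ (≈q e) k
    ; start⇒      = λ (h , k) → coprime-≈ p⊥q k≡pq h k
    ; ⇒start      = λ e → ≈p e , ≈q e
    ; accept⇒     = λ {(r₁ , r₂)} ac e → let a , b = to T-∧ ac in P.containsZero⇒ r₁ a (≈p e) , Q.containsZero⇒ r₂ b (≈q e)
    ; ⇒accept     = λ {(r₁ , r₂)} (h , k) e → from T-∧ (P.⇒containsZero r₁ h (≈p e) , Q.⇒containsZero r₂ k (≈q e))
    ; forward     = λ {u} {r} {x} {y} → forth u r x y
    ; backward    = λ {r} {t} {x} {y} → back r t x y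
    }
    where
    ≈p : ∀ {x y} → Congruence._≈_ (+ k) x y → x P.≈ y
    ≈p = ∣⇒≈ (subst (p ℕ∣.∣_) (sym k≡pq) (ℕ∣.m∣m*n q))
    ≈q : ∀ {x y} → Congruence._≈_ (+ k) x y → x Q.≈ y
    ≈q = ∣⇒≈ (subst (q ℕ∣.∣_) (sym k≡pq) (ℕ∣.n∣m*n p))

    forth : ∀ u r x y → SameSign u → (x P.∈ᴿ proj₁ r) × (x Q.∈ᴿ proj₂ r) →
      ∃[ t ] t ∈ map (pairStep P.κ Q.κ r (pairLetter y)) signs ×
        (x + u * y P.∈ᴿ proj₁ t) × (x + u * y Q.∈ᴿ proj₂ t)
    forth u (r₁ , r₂) x y (s , hu , ku) (h , k) =
      let c , hc = P.class-of y
          d , hd = Q.class-of y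
          n = normaliser c d
      -- A weight of sign `s` acts on the actual classes of `y` as the sign `s * n` acts on the
      -- normalised ones.
      in pairStep P.κ Q.κ (r₁ , r₂) (classPair c d) (s Sign.* n) ,
         ∈-map⁺ (pairStep P.κ Q.κ (r₁ , r₂) (classPair c d)) (∈-signs (s Sign.* n)) ,
         P.signStep-sound 5<p r₁ h (subst (λ e → P.HasClass e (u * y)) (move s n c (normalise-fst c d)) (P.class-* hu hc)) ,
         Q.signStep-sound 5<q r₂ k (subst (λ e → Q.HasClass e (u * y)) (move s n d (normalise-snd c d)) (Q.class-* ku hd))

    back : ∀ r t x y → t ∈ map (pairStep P.κ Q.κ r (pairLetter y)) signs → (x P.∈ᴿ proj₁ t) × (x Q.∈ᴿ proj₂ t) →
      ∃[ u ] SameSign u × (x - u * y P.∈ᴿ proj₁ r) × (x - u * y Q.∈ᴿ proj₂ r)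
    back (r₁ , r₂) t x y t∈ (h , k) with ∈-map⁻ (pairStep P.κ Q.κ (r₁ , r₂) (pairLetter y)) t∈
    ... | s , _ , refl =
      let c , hc = P.class-of y
          d , hd = Q.class-of y
          n = normaliser c d
          v , hv , h′ = P.signStep-complete 5<p r₁ (s · fst (classPair c d)) h
          w , hw , k′ = Q.signStep-complete 5<q r₂ (s · snd (classPair c d)) k
          unmove : ∀ e {f} → n · e ≡ f → s · f ≡ (s Sign.* n) · e
          unmove = λ { e refl → sym (·-assoc s n e) }
          u₁ , hu₁ , e₁ = P.class-divide (s Sign.* n) hc (subst (λ e → P.HasClass e v) (unmove c (normalise-fst c d)) hv)
          u₂ , hu₂ , e₂ = Q.class-divide (s Sign.* n) hd (subst (λ e → Q.HasClass e w) (unmove d (normalise-snd c d)) hw)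
          u , f₁ , f₂ = chinese-remainder p⊥q u₁ u₂
      in u , (s Sign.* n , P.sign-resp (P.≈-sym f₁) hu₁ , Q.sign-resp (Q.≈-sym f₂) hu₂) ,
         P.range-resp r₁ (P.+-cong (P.≈-refl {x}) (P.-‿cong (P.≈-trans (P.≈-sym e₁) (P.*-congʳ y (P.≈-sym f₁))))) h′ ,
         Q.range-resp r₂ (Q.+-cong (Q.≈-refl {x}) (Q.-‿cong (Q.≈-trans (Q.≈-sym e₂) (Q.*-congʳ y (Q.≈-sym f₂))))) k′

-- The combinatorics of three primes, by exhaustion

open Automaton using (accepts; search; next; start)

record Finite (A : Set) : Set where
  field
    elements : List A
    complete : ∀ x → x ∈ elements

  every : (A → Bool) → Bool
  every f = all f elements

  every-elim : (f : A → Bool) → T (every f) → ∀ x → T (f x)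
  every-elim f h x = All.lookup (all⁺ f elements h) (complete x)

open Finite {{...}}

instance
  Bool-finite : Finite Bool
  Bool-finite = record { elements = false ∷ true ∷ [] ; complete = λ { false → here refl ; true → there (here refl) } }

  Sign-finite : Finite Sign
  Sign-finite = record { elements = signs ; complete = ∈-signs }

  ClassPair-finite : Finite ClassPair
  ClassPair-finite = record
    { elements = neither ∷ left ∷ right ∷ map both signs
    ; complete = λ
      { neither  → here refl
      ; left     → there (here refl)
      ; right    → there (there (here refl))
      ; (both s) → there (there (there (∈-map⁺ both (∈-signs s))))
      }
    }

  ×-finite : ∀ {A B} {{_ : Finite A}} {{_ : Finite B}} → Finite (A × B)
  ×-finite = record
    { elements = cartesianProduct elements elements
    ; complete = λ (x , y) → ∈-cartesianProduct⁺ (complete x) (complete y)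
    }

T-not : ∀ {b} → T (not b) ⇔ (¬ T b)
T-not {false} = mk⇔ (λ _ ()) (λ _ → tt)
T-not {true}  = mk⇔ (λ ()) (λ ¬t → ¬t tt)

Letter : Set
Letter = ClassPair × Bool

jacobiAutomaton : Sign → Sign → Automaton
jacobiAutomaton κ₁ κ₂ = pairAutomaton κ₁ κ₂ ⊗ unitAutomaton

unitPair : ClassPair → Bool × Bool
unitPair c = isUnit (fst c) , isUnit (snd c)

unitTriple : Letter → (Bool × Bool) × Bool
unitTriple (c , b) = unitPair c , b

acceptsU : List Letter → Bool
acceptsU = accepts ((unitAutomaton ⊗ unitAutomaton) ⊗ unitAutomaton) ∘ map unitTriple

acceptsU′ : List ClassPair → Bool
acceptsU′ = accepts (unitAutomaton ⊗ unitAutomaton) ∘ map unitPair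

isNeither : ClassPair → Bool
isNeither neither = true
isNeither _       = false

-- Forms (i) and (ii): i, j, k tell which terms are units modulo p, e whether
-- the third one vanishes modulo q r, s and s′ whether the first and the last
-- two terms have an S-weighted zero-sum subsequence modulo q r, and u whether
-- the last two have a U-weighted one.
exceptional : (i j k s e s′ u : Bool) → Bool
exceptional i j k s e s′ u = (not s ∧ k ∧ e) ∨ (i ∧ not j ∧ not k ∧ not s′ ∧ u)

exceptional⇔ : ∀ i j k s e s′ u → T (exceptional i j k s e s′ u) ⇔
  ( (¬ T s × T k × T e) ⊎ (T i × ¬ T j × ¬ T k × ¬ T s′ × T u) )
exceptional⇔ i j k s e s′ u = mk⇔ forth back
  where
  forth : T (exceptional i j k s e s′ u) → (¬ T s × T k × T e) ⊎ (T i × ¬ T j × ¬ T k × ¬ T s′ × T u)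
  forth h with to T-∨ h
  ... | inj₁ h₁ =
    let a , h₂ = to T-∧ h₁
        b , c = to T-∧ h₂
    in inj₁ (to T-not a , b , c)
  ... | inj₂ h₁ =
    let a , h₂ = to T-∧ h₁
        b , h₃ = to T-∧ h₂
        c , h₄ = to T-∧ h₃
        d , f = to T-∧ h₄
    in inj₂ (a , to T-not b , to T-not c , to T-not d , f)
  back : (¬ T s × T k × T e) ⊎ (T i × ¬ T j × ¬ T k × ¬ T s′ × T u) → T (exceptional i j k s e s′ u)
  back (inj₁ (a , b , c)) = from T-∨ (inj₁ (from T-∧ (from T-not a , from T-∧ (b , c))))
  back (inj₂ (a , b , c , d , f)) = from (T-∨ {not s ∧ k ∧ e}) (inj₂
    (from T-∧ (a , from T-∧ (from T-not b , from T-∧ (from T-not c , from T-∧ (from T-not d , f))))))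

form : Sign → Sign → Letter → Letter → Letter → Bool
form κ₁ κ₂ (c , i) (d , j) (e , k) = exceptional i j k
  (accepts (pairAutomaton κ₁ κ₂) (c ∷ d ∷ [])) (isNeither e)
  (accepts (pairAutomaton κ₁ κ₂) (d ∷ e ∷ [])) (acceptsU′ (d ∷ e ∷ []))

Exceptional : Sign → Sign → Letter → Letter → Letter → Set
Exceptional κ₁ κ₂ (c , i) (d , j) (e , k) =
  (¬ T (accepts (pairAutomaton κ₁ κ₂) (c ∷ d ∷ [])) × T k × T (isNeither e)) ⊎
  (T i × ¬ T j × ¬ T k × ¬ T (accepts (pairAutomaton κ₁ κ₂) (d ∷ e ∷ [])) × T (acceptsU′ (d ∷ e ∷ [])))

form⇔ : ∀ κ₁ κ₂ x y z → T (form κ₁ κ₂ x y z) ⇔ Exceptional κ₁ κ₂ x y z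
form⇔ κ₁ κ₂ (c , i) (d , j) (e , k) = exceptional⇔ i j k
  (accepts (pairAutomaton κ₁ κ₂) (c ∷ d ∷ [])) (isNeither e)
  (accepts (pairAutomaton κ₁ κ₂) (d ∷ e ∷ [])) (acceptsU′ (d ∷ e ∷ []))

module _ (M : Automaton) {{_ : Finite (Automaton.Letter M)}} (first : Automaton.Letter M → Automaton.State M) where
  open Automaton M using () renaming (Letter to Symbol)

  -- Treats all words with one extra letter in front. If the tail is not accepted by itself, a zero
  -- sum must select the new letter; only then is there a loop over that letter, and its transition
  -- is prescribed by `first` to halve the search.
  oneMore : List Symbol → Bool
  oneMore xs = accepts M xs ∨ every (λ w → search M true (first w) xs)

  oneMore-sound : (∀ w → first w ∈ next M (start M) w) → ∀ xs → T (oneMore xs) → ∀ w → T (accepts M (w ∷ xs))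
  oneMore-sound first∈ xs h w =
    [ Automaton.search-skip M false (start M) w xs
    , (λ e → Automaton.search-read M false (start M) w xs (first∈ w)
               (every-elim (λ w → search M true (first w) xs) e w))
    ]′ (to (T-∨ {accepts M xs}) h)

every₃ : ∀ {A} {{_ : Finite A}} → (Sign → Sign → A → A → A → Bool) → Bool
every₃ f = every λ κ₁ → every λ κ₂ → every λ x → every λ y → every λ z → f κ₁ κ₂ x y z

-- The type `T (every₃ f)` evaluates to `⊤` and forgets `f`; the record keeps `f` as a parameter,
-- from which `instantiate` can recover it.
record Valid {A : Set} {{_ : Finite A}} (f : Sign → Sign → A → A → A → Bool) : Set where
  constructor valid
  field
    exhaustion : T (every₃ f)

instantiate : ∀ {A} {{_ : Finite A}} {f : Sign → Sign → A → A → A → Bool} → Valid f →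
  ∀ κ₁ κ₂ x y z → T (f κ₁ κ₂ x y z)
instantiate {f = f} (valid h) κ₁ κ₂ x y z =
  every-elim (f κ₁ κ₂ x y)
    (every-elim (λ y → every (f κ₁ κ₂ x y))
      (every-elim (λ x → every λ y → every (f κ₁ κ₂ x y))
        (every-elim (λ κ₂ → every λ x → every λ y → every (f κ₁ κ₂ x y))
          (every-elim (λ κ₁ → every λ κ₂ → every λ x → every λ y → every (f κ₁ κ₂ x y)) h κ₁) κ₂) x) y) z

-- By symmetry the first weight may be taken to be a square modulo both primes.
squareFirst : Sign → Sign → Letter → (Range × Range) × Range
squareFirst κ₁ κ₂ (c , b) = pairStep κ₁ κ₂ (none , none) c Sign.+ , unitStep none b

abstract
  threeS : Valid λ κ₁ κ₂ x y z → accepts (pairAutomaton κ₁ κ₂) (x ∷ y ∷ z ∷ [])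
  threeS = valid tt

  fourL : Valid λ κ₁ κ₂ x y z →
    oneMore (jacobiAutomaton κ₁ κ₂) (squareFirst κ₁ κ₂) (x ∷ y ∷ z ∷ [])
  fourL = valid tt

  -- Three cyclic rotations replace the six orders: the first form is symmetric in its first two
  -- terms and the second form in its last two, so only the distinguished term has to be chosen.
  classification : Valid λ κ₁ κ₂ x y z →
    accepts (jacobiAutomaton κ₁ κ₂) (x ∷ y ∷ z ∷ []) ∨ not (acceptsU (x ∷ y ∷ z ∷ [])) ∨
    form κ₁ κ₂ x y z ∨ form κ₁ κ₂ y z x ∨ form κ₁ κ₂ z x y
  classification = valid tt

  -- Only the exceptional forms call for a computation: a sequence without zero sums for `U` has
  -- none for the smaller set `L`.
  converse : Valid λ κ₁ κ₂ x y z → not (form κ₁ κ₂ x y z) ∨ not (accepts (jacobiAutomaton κ₁ κ₂) (x ∷ y ∷ z ∷ []))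
  converse = valid tt

classify : ∀ κ₁ κ₂ x y z → ¬ T (accepts (jacobiAutomaton κ₁ κ₂) (x ∷ y ∷ z ∷ [])) →
  ¬ T (acceptsU (x ∷ y ∷ z ∷ [])) ⊎
  Exceptional κ₁ κ₂ x y z ⊎ Exceptional κ₁ κ₂ y z x ⊎ Exceptional κ₁ κ₂ z x y
classify κ₁ κ₂ x y z ¬a =
  cases (accepts (jacobiAutomaton κ₁ κ₂) (x ∷ y ∷ z ∷ [])) (acceptsU (x ∷ y ∷ z ∷ []))
    (form κ₁ κ₂ x y z) (form κ₁ κ₂ y z x) (form κ₁ κ₂ z x y)
    (to (form⇔ κ₁ κ₂ x y z)) (to (form⇔ κ₁ κ₂ y z x)) (to (form⇔ κ₁ κ₂ z x y))
    (instantiate classification κ₁ κ₂ x y z) ¬a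
  where
  cases : ∀ {F G H : Set} a u f g h → (T f → F) → (T g → G) → (T h → H) →
    T (a ∨ not u ∨ f ∨ g ∨ h) → ¬ T a → ¬ T u ⊎ F ⊎ G ⊎ H
  cases a u f g h F G H t ¬a with to (T-∨ {a}) t
  ... | inj₁ ta = contradiction ta ¬a
  ... | inj₂ t with to (T-∨ {not u}) t
  ...   | inj₁ ¬tu = inj₁ (to T-not ¬tu)
  ...   | inj₂ t with to (T-∨ {f}) t
  ...     | inj₁ tf = inj₂ (inj₁ (F tf))
  ...     | inj₂ t with to (T-∨ {g}) t
  ...       | inj₁ tg = inj₂ (inj₂ (inj₁ (G tg)))
  ...       | inj₂ th = inj₂ (inj₂ (inj₂ (H th)))

exceptional⇒¬accepts : ∀ κ₁ κ₂ x y z → Exceptional κ₁ κ₂ x y z →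
  ¬ T (accepts (jacobiAutomaton κ₁ κ₂) (x ∷ y ∷ z ∷ []))
exceptional⇒¬accepts κ₁ κ₂ x y z ex =
  implies (form κ₁ κ₂ x y z) (accepts (jacobiAutomaton κ₁ κ₂) (x ∷ y ∷ z ∷ []))
    (instantiate converse κ₁ κ₂ x y z) (from (form⇔ κ₁ κ₂ x y z) ex)
  where
  implies : ∀ f a → T (not f ∨ not a) → T f → ¬ T a
  implies f a h t = [ (λ ¬f → contradiction t (to T-not ¬f)) , to T-not ]′ (to T-∨ h)

accepts-four : ∀ κ₁ κ₂ w x y z → T (accepts (jacobiAutomaton κ₁ κ₂) (w ∷ x ∷ y ∷ z ∷ []))
accepts-four κ₁ κ₂ w x y z = oneMore-sound (jacobiAutomaton κ₁ κ₂) (squareFirst κ₁ κ₂)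
  (λ _ → here refl) (x ∷ y ∷ z ∷ []) (instantiate fourL κ₁ κ₂ x y z) w

accepts-three : ∀ κ₁ κ₂ x y z → T (accepts (pairAutomaton κ₁ κ₂) (x ∷ y ∷ z ∷ []))
accepts-three = instantiate threeS

-- Residue rings, units, Jacobi symbols and Davenport constants

ι : ∀ {m} → ℤ/ m → ℤ
ι x = + toℕ x

module Residues (m : ℕ) .{{_ : NonZero m}} where
  open Congruence (+ m)

  ι-⟦⟧ : ∀ a → ι {m} ⟦ a ⟧ ≈ + a
  ι-⟦⟧ a = ≈-sym (congruent (divides (+ (a ℕ./ m)) eq))
    where
    open Int using (_+_; _*_; _-_)
    cancel : ∀ a b → (a + b) - a ≡ b
    cancel = solve-∀
    eq : + a - ι {m} ⟦ a ⟧ ≡ + (a ℕ./ m) * + m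
    eq = trans (cong₂ _-_ (cong +_ (m≡m%n+[m/n]*n a m)) (cong +_ (toℕ-fromℕ< (m%n<n a m))))
      (trans (cancel (+ (a ℕ.% m)) (+ (a ℕ./ m ℕ.* m))) (ℤₚ.pos-* (a ℕ./ m) m))

  ι-+ : ∀ (x y : ℤ/ m) → ι (x +ₘ y) ≈ ι x Int.+ ι y
  ι-+ x y = ι-⟦⟧ (toℕ x ℕ.+ toℕ y)

  ι-* : ∀ (x y : ℤ/ m) → ι (x *ₘ y) ≈ ι x Int.* ι y
  ι-* x y = ≈-trans (ι-⟦⟧ (toℕ x ℕ.* toℕ y)) (≈-reflexive (ℤₚ.pos-* (toℕ x) (toℕ y)))

  ι-injective : ∀ {x y : ℤ/ m} → ι x ≈ ι y → x ≡ y
  ι-injective {x} {y} e = toℕ-injective (≈-small⇒≡ (toℕ<n x) (toℕ<n y) e)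

  ι≈⇒≡⟦⟧ : ∀ {x : ℤ/ m} {a} → ι x ≈ + a → x ≡ ⟦ a ⟧
  ι≈⇒≡⟦⟧ {a = a} e = ι-injective (≈-trans e (≈-sym (ι-⟦⟧ a)))

  ≡⟦⟧⇒ι≈ : ∀ {x : ℤ/ m} {a} → x ≡ ⟦ a ⟧ → ι x ≈ + a
  ≡⟦⟧⇒ι≈ {a = a} refl = ι-⟦⟧ a

  ∣ₘ⇔≈0 : ∀ {d} {x : ℤ/ m} → d ℕ∣.∣ m → (⟦ d ⟧ ∣ₘ x) ⇔ Congruence._≈_ (+ d) (ι x) 0ℤ
  ∣ₘ⇔≈0 {d} {x} d∣m = mk⇔ forth back
    where
    module D = Congruence (+ d)
    forth : ⟦ d ⟧ ∣ₘ x → ι x D.≈ 0ℤ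
    forth (c , refl) = D.≈-trans (∣⇒≈ d∣m (≈-trans (ι-* c ⟦ d ⟧) (*-congˡ (ι c) (ι-⟦⟧ d))))
      (D.∣⇒≈0 (divides (ι c) refl))
    back : ι x D.≈ 0ℤ → ⟦ d ⟧ ∣ₘ x
    back e with ℤ∣.∣⇒∣ᵤ (D.≈0⇒∣ e)
    ... | ℕ∣.divides c eq = ⟦ c ⟧ , sym (ι-injective (≈-sym (≈-trans (ι-* ⟦ c ⟧ ⟦ d ⟧)
      (≈-trans (*-cong (ι-⟦⟧ c) (ι-⟦⟧ d)) (≈-reflexive (trans (sym (ℤₚ.pos-* c d)) (cong +_ (sym eq))))))))

  module _ {A : Pred (ℤ/ m) 0ℓ} {B : ℤ → Set} (A⇔B : ∀ x → A x ⇔ B (ι x)) where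

    sublist⇒selection : ∀ {xs ys as} → ys ⊆ xs → length as ≡ length ys → All A as →
      ∃[ s ] Selection B (not (null ys)) (map ι xs) s × s ≈ ι (sumₘ (zipWith _*ₘ_ as ys))
    sublist⇒selection {as = []} [] _ _ = 0ℤ , [] , ≈-sym (ι-⟦⟧ 0)
    sublist⇒selection (y ∷ʳ p) len all-A =
      let s , σ , e = sublist⇒selection p len all-A in s , skip σ , e
    sublist⇒selection {y ∷ xs} {y ∷ ys} {a ∷ as} (refl ∷ p) len (Aa ∷ all-A) =
      let s , σ , e = sublist⇒selection p (ℕₚ.suc-injective len) all-A
      in ι a Int.* ι y Int.+ s , weigh (to (A⇔B a) Aa) σ ,
         ≈-sym (≈-trans (ι-+ (a *ₘ y) (sumₘ (zipWith _*ₘ_ as ys))) (+-cong (ι-* a y) (≈-sym e)))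

    selection⇒sublist : (∀ {u v} → u ≈ v → B u → B v) → ∀ {b s} xs → Selection B b (map ι xs) s →
      ∃₂ λ ys as → ys ⊆ xs × null ys ≡ not b × length as ≡ length ys × All A as ×
        s ≈ ι (sumₘ (zipWith _*ₘ_ as ys))
    selection⇒sublist resp [] [] = [] , [] , [] , refl , refl , [] , ≈-sym (ι-⟦⟧ 0)
    selection⇒sublist resp (x ∷ xs) (skip σ) =
      let ys , as , p , b , len , all-A , e = selection⇒sublist resp xs σ
      in ys , as , x ∷ʳ p , b , len , all-A , e
    selection⇒sublist resp (x ∷ xs) (weigh {u = u} Bu σ) =
      let ys , as , p , b , len , all-A , e = selection⇒sublist resp xs σ
          a = residue m u
      in x ∷ ys , a ∷ as , refl ∷ p , refl , cong suc len ,
         from (A⇔B a) (resp (≈-sym (residue-≈ m u)) Bu) ∷ all-A ,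
         ≈-sym (≈-trans (ι-+ (a *ₘ x) (sumₘ (zipWith _*ₘ_ as ys)))
           (+-cong (≈-trans (ι-* a x) (*-congʳ (ι x) (residue-≈ m u))) (≈-sym e)))

    hasWeightedZeroSumSubsequence⇔zeroSum : (∀ {u v} → u ≈ v → B u → B v) → ∀ xs →
      HasWeightedZeroSumSubsequence A xs ⇔ ZeroSum m B (map ι xs)
    hasWeightedZeroSumSubsequence⇔zeroSum resp xs = mk⇔ forth back
      where
      forth : HasWeightedZeroSumSubsequence A xs → ZeroSum m B (map ι xs)
      forth ([] , _ , ys≢[] , _) = contradiction refl ys≢[]
      forth (y ∷ ys , p , _ , as , len , all-A , eq) =
        let s , σ , e = sublist⇒selection p len all-A in s , σ , ≈-trans e (≡⟦⟧⇒ι≈ eq)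
      back : ZeroSum m B (map ι xs) → HasWeightedZeroSumSubsequence A xs
      back (s , σ , s≈0) =
        let ys , as , p , b , len , all-A , e = selection⇒sublist resp xs σ
        in ys , p , nonempty b , as , len , all-A , ι≈⇒≡⟦⟧ (≈-trans (≈-sym e) s≈0)
        where
        nonempty : ∀ {ys : List (ℤ/ m)} → null ys ≡ false → ys ≢ []
        nonempty () refl

module _ {m : ℕ} .{{_ : NonZero m}} where

  hasWeightedZeroSumSubsequence-mono : ∀ {A B : Pred (ℤ/ m) 0ℓ} → (∀ {x} → A x → B x) →
    ∀ {xs} → HasWeightedZeroSumSubsequence A xs → HasWeightedZeroSumSubsequence B xs
  hasWeightedZeroSumSubsequence-mono A⊆B (ys , p , ys≢[] , as , len , all-A , e) =
    ys , p , ys≢[] , as , len , All.map A⊆B all-A , e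

  module _ {A : Pred (ℤ/ m) 0ℓ} where

    -- A free word of length `k` has free prefixes of all smaller lengths, so no j ≤ k has the
    -- defining property.
    davenportConstant : ∀ {k} → EverySequenceOfLength A (suc k) →
      ∀ w → length w ≡ k → ¬ HasWeightedZeroSumSubsequence A w → IsDavenportConstant A (suc k)
    davenportConstant {k} every w len ¬w = s≤s z≤n , every , λ j _ every-j → ℕₚ.≮⇒≥ (short j every-j)
      where
      short : ∀ j → EverySequenceOfLength A j → ¬ (j ℕ.< suc k)
      short j every-j (s≤s j≤k) =
        let ys , p , z = every-j (take j w)
              (trans (length-take j w) (ℕₚ.m≤n⇒m⊓n≡m (ℕₚ.≤-trans j≤k (ℕₚ.≤-reflexive (sym len)))))
        in ¬w (ys , ⊆-trans p (take-⊆ j w) , z)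

    -- The Davenport constant is given as a relation, so the length hidden in an extremal sequence
    -- is identified by the uniqueness of a least element.
    isDExtremal⇔ : ∀ {k} → ¬ A ⟦ 0 ⟧ → IsDavenportConstant A (suc k) → ∀ xs →
      IsDExtremal A xs ⇔ (length xs ≡ k × ¬ HasWeightedZeroSumSubsequence A xs)
    isDExtremal⇔ {k} 0∉A D@(0<k , every , least) xs = mk⇔
      (λ (_ , (j , (0<j , every-j , least-j) , len) , ¬z) →
        trans len (cong (ℕ._∸ 1) (ℕₚ.≤-antisym (least-j (suc k) 0<k every) (least j 0<j every-j))) , ¬z)
      (λ (len , ¬z) → 0∉A , (suc k , D , len) , ¬z)

-- Invertible residues and the Jacobi symbol of a given factorisation

record Invertible (m : ℕ) (x : ℤ) : Set where
  constructor invertible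
  field
    reciprocal : ℤ
    *≈1        : Congruence._≈_ (+ m) (x Int.* reciprocal) 1ℤ

U⇔invertible : ∀ m .{{_ : NonZero m}} (x : ℤ/ m) → U m x ⇔ Invertible m (ι x)
U⇔invertible m x = mk⇔
  (λ (y , e) → invertible (ι y) (≈-trans (≈-sym (ι-* x y)) (≡⟦⟧⇒ι≈ e)))
  (λ (invertible y e) → residue m y , ι≈⇒≡⟦⟧ (≈-trans (ι-* x (residue m y)) (≈-trans (*-congˡ (ι x) (residue-≈ m y)) e)))
  where
  open Residues m
  open Congruence (+ m)

invertible-* : ∀ {m n k x} → Coprime m n → k ≡ m ℕ.* n → Invertible k x ⇔ (Invertible m x × Invertible n x)
invertible-* {m} {n} {k} {x} c k≡mn = mk⇔
  (λ (invertible y e) → invertible y (∣⇒≈ (subst (m ℕ∣.∣_) (sym k≡mn) (ℕ∣.m∣m*n n)) e)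
                      , invertible y (∣⇒≈ (subst (n ℕ∣.∣_) (sym k≡mn) (ℕ∣.n∣m*n m)) e))
  (λ (invertible y e , invertible z f) →
    let w , w≈y , w≈z = chinese-remainder c y z
    in invertible w (coprime-≈ c k≡mn (M.≈-trans (M.*-congˡ x w≈y) e) (N.≈-trans (N.*-congˡ x w≈z) f)))
  where
  module M = Congruence (+ m)
  module N = Congruence (+ n)

invertible-prime : ∀ {p x} → Prime p → Invertible p x ⇔ Congruence._≉_ (+ p) x 0ℤ
invertible-prime {p} {x} p-prime = mk⇔
  (λ (invertible y e) → *≈1⇒≉0 {x} {y} e)
  (λ x≉0 → let y , e = inverse x≉0 in invertible y e)
  where open PrimeField p-prime

distance-⊖ : ∀ m n → ∣ m ⊖ n ∣ ≡ ℕ.∣ m - n ∣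
distance-⊖ zero    zero    = refl
distance-⊖ zero    (suc n) = refl
distance-⊖ (suc m) zero    = refl
distance-⊖ (suc m) (suc n) = trans (cong ∣_∣ (ℤₚ.[1+m]⊖[1+n]≡m⊖n m n)) (distance-⊖ m n)

∣distance⇔≈ : ∀ {p m n} → p ℕ∣.∣ ℕ.∣ m - n ∣ ⇔ Congruence._≈_ (+ p) (+ m) (+ n)
∣distance⇔≈ {p} {m} {n} = mk⇔
  (λ d → Congruence.congruent (ℤ∣.∣ᵤ⇒∣ (subst (p ℕ∣.∣_) (sym eq) d)))
  (λ (Congruence.congruent d) → subst (p ℕ∣.∣_) eq (ℤ∣.∣⇒∣ᵤ d))
  where
  eq : ∣ + m Int.- + n ∣ ≡ ℕ.∣ m - n ∣
  eq = trans (cong ∣_∣ (ℤₚ.m-n≡m⊖n m n)) (distance-⊖ m n)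

signValue : Sign → ℤ
signValue Sign.+ = 1ℤ
signValue Sign.- = -1ℤ

module _ {p : ℕ} (p-prime : Prime p) (2<p : 2 ℕ.< p) where
  open QuadraticCharacter p-prime 2<p

  legendre≡ : ∀ {s a} → HasSign s (+ a) → legendre a p ≡ signValue s
  legendre≡ {s} {a} h with p ℕ∣.∣? a
  ... | yes p∣a = contradiction (∣ᵤ⇒≈0 p∣a) (nonzero h)
  ... | no  _ with any? (λ (x : Fin p) → p ℕ∣.∣? ℕ.∣ toℕ x ℕ.* toℕ x - a ∣) | h
  ...   | yes _ | square _ _ = refl
  ...   | yes (x , d) | nonsquare _ ¬□ = contradiction (+ toℕ x , root x d) ¬□
    where
    root : ∀ x → p ℕ∣.∣ ℕ.∣ toℕ x ℕ.* toℕ x - a ∣ → + toℕ {p} x Int.* + toℕ x ≈ + a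
    root x d = ≈-trans (≈-reflexive (sym (ℤₚ.pos-* (toℕ x) (toℕ x)))) (to ∣distance⇔≈ d)
  ...   | no ¬∃ | square _ (y , e) = contradiction (root y e) ¬∃
    where
    instance _ = prime⇒nonZero p-prime
    root : ∀ y → y Int.* y ≈ + a → ∃[ x ] p ℕ∣.∣ ℕ.∣ toℕ {p} x ℕ.* toℕ x - a ∣
    root y e = residue p y , from ∣distance⇔≈
      (≈-trans (≈-reflexive (ℤₚ.pos-* (toℕ (residue p y)) (toℕ (residue p y))))
        (≈-trans (*-cong (residue-≈ p y) (residue-≈ p y)) e))
  ...   | no _ | nonsquare _ _ = refl

-- By unique factorisation the list that defines the symbol is a permutation of `ps`, and a product
-- in a commutative monoid does not depend on the order.
jacobi-factors : ∀ {m ps} .{{_ : NonZero m}} → All Prime ps → m ≡ product ps → ∀ a →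
  jacobi a m ≡ foldr Int._*_ 1ℤ (map (legendre a) ps)
jacobi-factors {m} primes eq a =
  PermSetoid.foldr-commMonoid (setoid ℤ) ℤₚ.*-1-isCommutativeMonoid
    (↭⇒↭ₛ (Permₚ.map⁺ (legendre a) (factorisationUnique (factorise m) record
      { factors = _ ; isFactorisation = eq ; factorsPrime = primes })))

-- Products of three primes

open import Data.Nat.Base using (_*_; _≤_)
open import Data.Nat.Divisibility using (_∣_)

distinct-primes⇒coprime : ∀ {p q} → Prime p → Prime q → p ≢ q → Coprime p q
distinct-primes⇒coprime p-prime q-prime p≢q = prime∤⇒coprime p-prime λ p∣q →
  [ (λ { refl → ¬prime[1] p-prime }) , p≢q ]′ (prime⇒irreducible q-prime p∣q)

module ThreePrimes
  {q r p : ℕ} (q-prime : Prime q) (r-prime : Prime r) (p-prime : Prime p)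
  (7≤q : 7 ≤ q) (7≤r : 7 ≤ r) (7≤p : 7 ≤ p) (q≢r : q ≢ r) (q≢p : q ≢ p) (r≢p : r ≢ p)
  {n n′ : ℕ} .{{_ : NonZero n}} .{{_ : NonZero n′}} .{{_ : NonZero p}}
  (n′≡qr : n′ ≡ q * r) (n≡n′p : n ≡ n′ * p) where

  private
    7≤⇒2< : ∀ {k} → 7 ≤ k → 2 ℕ.< k
    7≤⇒2< = ℕₚ.≤-trans (s≤s (s≤s (s≤s z≤n)))
    7≤⇒5< : ∀ {k} → 7 ≤ k → 5 ℕ.< k
    7≤⇒5< = ℕₚ.≤-trans (s≤s (s≤s (s≤s (s≤s (s≤s (s≤s z≤n))))))

    q⊥r : Coprime q r
    q⊥r = distinct-primes⇒coprime q-prime r-prime q≢r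

    n′⊥p : Coprime n′ p
    n′⊥p = Coprimality.sym (prime∤⇒coprime p-prime λ p∣n′ →
      [ (λ p∣q → q≢p (sym (prime-∣ q-prime p∣q))) , (λ p∣r → r≢p (sym (prime-∣ r-prime p∣r))) ]′
        (euclidsLemma q r p-prime (subst (p ∣_) n′≡qr p∣n′)))
      where
      prime-∣ : ∀ {k} → Prime k → p ∣ k → p ≡ k
      prime-∣ k-prime p∣k = [ (λ { refl → contradiction p-prime ¬prime[1] }) , id ]′ (prime⇒irreducible k-prime p∣k)

    q∣n′ : q ∣ n′
    q∣n′ = subst (q ∣_) (sym n′≡qr) (ℕ∣.m∣m*n r)
    r∣n′ : r ∣ n′
    r∣n′ = subst (r ∣_) (sym n′≡qr) (ℕ∣.n∣m*n q)
    n′∣n : n′ ∣ n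
    n′∣n = subst (n′ ∣_) (sym n≡n′p) (ℕ∣.m∣m*n p)
    p∣n : p ∣ n
    p∣n = subst (p ∣_) (sym n≡n′p) (ℕ∣.n∣m*n n′)

  module Q = QuadraticCharacter q-prime (7≤⇒2< 7≤q)
  module R = QuadraticCharacter r-prime (7≤⇒2< 7≤r)
  module P = QuadraticCharacter p-prime (7≤⇒2< 7≤p)
  module UQ = UnitModel q-prime (7≤⇒2< 7≤q) (7≤⇒5< 7≤q)
  module UR = UnitModel r-prime (7≤⇒2< 7≤r) (7≤⇒5< 7≤r)
  module UP = UnitModel p-prime (7≤⇒2< 7≤p) (7≤⇒5< 7≤p)
  module QR = PairModel q-prime (7≤⇒2< 7≤q) (7≤⇒5< 7≤q) r-prime (7≤⇒2< 7≤r) (7≤⇒5< 7≤r) q⊥r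
  module N  = Congruence (+ n)
  module N′ = Congruence (+ n′)
  open QR using (SameSign; pairLetter)

  private
    split-n′ : ∀ {x y} → x N′.≈ y → x Q.≈ y × x R.≈ y
    split-n′ e = ∣⇒≈ q∣n′ e , ∣⇒≈ r∣n′ e

    join-n′ : ∀ {x y} → x Q.≈ y → x R.≈ y → x N′.≈ y
    join-n′ = coprime-≈ q⊥r n′≡qr

    join-n : ∀ {x y} → x N′.≈ y → x P.≈ y → x N.≈ y
    join-n = coprime-≈ n′⊥p n≡n′p

  UnitsQR : ℤ → Set
  UnitsQR u = u Q.≉ 0ℤ × u R.≉ 0ℤ

  S-model : Model (pairAutomaton Q.κ R.κ) n′ SameSign
  S-model = QR.pair-model n′≡qr

  U′-model : Model (unitAutomaton ⊗ unitAutomaton) n′ UnitsQR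
  U′-model = product-model q⊥r n′≡qr UQ.unit-model UR.unit-model

  L-model : Model (jacobiAutomaton Q.κ R.κ) n (λ u → SameSign u × u P.≉ 0ℤ)
  L-model = product-model n′⊥p n≡n′p S-model UP.unit-model

  U-model : Model ((unitAutomaton ⊗ unitAutomaton) ⊗ unitAutomaton) n (λ u → UnitsQR u × u P.≉ 0ℤ)
  U-model = product-model n′⊥p n≡n′p U′-model UP.unit-model

  U′⇔units : ∀ x → U n′ x ⇔ UnitsQR (ι x)
  U′⇔units x = ⇔-trans (U⇔invertible n′ x) (⇔-trans (invertible-* q⊥r n′≡qr)
    (invertible-prime q-prime ×-⇔ invertible-prime r-prime))

  U⇔units : ∀ x → U n x ⇔ (UnitsQR (ι x) × ι x P.≉ 0ℤ)
  U⇔units x = ⇔-trans (U⇔invertible n x) (⇔-trans (invertible-* n′⊥p n≡n′p)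
    (⇔-trans (invertible-* q⊥r n′≡qr) (invertible-prime q-prime ×-⇔ invertible-prime r-prime)
      ×-⇔ invertible-prime p-prime))

  private
    jacobi-n′ : ∀ {s t a} → Q.HasSign s (+ a) → R.HasSign t (+ a) →
      jacobi a n′ ≡ signValue s Int.* (signValue t Int.* 1ℤ)
    jacobi-n′ {a = a} h k = trans
      (jacobi-factors (q-prime ∷ r-prime ∷ []) (trans n′≡qr (cong (q *_) (sym (ℕₚ.*-identityʳ r)))) a)
      (cong₂ (λ x y → x Int.* (y Int.* 1ℤ)) (legendre≡ q-prime (7≤⇒2< 7≤q) h) (legendre≡ r-prime (7≤⇒2< 7≤r) k))

    jacobi-p : ∀ {w a} → P.HasSign w (+ a) → jacobi a p ≡ signValue w Int.* 1ℤ
    jacobi-p {a = a} l = trans (jacobi-factors (p-prime ∷ []) (sym (ℕₚ.*-identityʳ p)) a)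
      (cong (Int._* 1ℤ) (legendre≡ p-prime (7≤⇒2< 7≤p) l))

    jacobi-n : ∀ {s t w a} → Q.HasSign s (+ a) → R.HasSign t (+ a) → P.HasSign w (+ a) →
      jacobi a n ≡ signValue s Int.* (signValue t Int.* (signValue w Int.* 1ℤ))
    jacobi-n {s} {t} {w} {a} h k l = trans
      (jacobi-factors (q-prime ∷ r-prime ∷ p-prime ∷ [])
        (trans n≡n′p (trans (cong (_* p) n′≡qr) product-of-three)) a)
      (trans (cong₂ (λ x y → x Int.* (y Int.* (legendre a p Int.* 1ℤ)))
          (legendre≡ q-prime (7≤⇒2< 7≤q) h) (legendre≡ r-prime (7≤⇒2< 7≤r) k))
        (cong (λ z → signValue s Int.* (signValue t Int.* (z Int.* 1ℤ))) (legendre≡ p-prime (7≤⇒2< 7≤p) l)))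
      where
      product-of-three : q * r * p ≡ product (q ∷ r ∷ p ∷ [])
      product-of-three = trans (ℕₚ.*-assoc q r p) (cong (λ k → q * (r * k)) (sym (ℕₚ.*-identityʳ p)))

    signs-agree : ∀ s t → signValue s Int.* (signValue t Int.* 1ℤ) ≡ 1ℤ → s ≡ t
    signs-agree Sign.+ Sign.+ _ = refl
    signs-agree Sign.- Sign.- _ = refl

    -- The character modulo p stands on both sides of the equation that defines `L`; being ±1, it
    -- cancels.
    signs-agree′ : ∀ s t w → signValue s Int.* (signValue t Int.* (signValue w Int.* 1ℤ)) ≡ signValue w Int.* 1ℤ → s ≡ t
    signs-agree′ Sign.+ Sign.+ _ _ = refl
    signs-agree′ Sign.- Sign.- _ _ = refl
    signs-agree′ Sign.+ Sign.- Sign.+ ()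
    signs-agree′ Sign.+ Sign.- Sign.- ()
    signs-agree′ Sign.- Sign.+ Sign.+ ()
    signs-agree′ Sign.- Sign.+ Sign.- ()

    square-one : ∀ s → signValue s Int.* (signValue s Int.* 1ℤ) ≡ 1ℤ
    square-one Sign.+ = refl
    square-one Sign.- = refl

    square-one′ : ∀ s w → signValue s Int.* (signValue s Int.* (signValue w Int.* 1ℤ)) ≡ signValue w Int.* 1ℤ
    square-one′ Sign.+ Sign.+ = refl
    square-one′ Sign.+ Sign.- = refl
    square-one′ Sign.- Sign.+ = refl
    square-one′ Sign.- Sign.- = refl

  S⇔sameSign : ∀ x → S n′ x ⇔ SameSign (ι x)
  S⇔sameSign x = mk⇔ forth back
    where
    forth : S n′ x → SameSign (ι x)
    forth (u , j) =
      let a , b = to (U′⇔units x) u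
          s , h = Q.sign-of a
          t , k = R.sign-of b
      in s , h , subst (λ t → R.HasSign t (ι x)) (sym (signs-agree s t (trans (sym (jacobi-n′ h k)) j))) k
    back : SameSign (ι x) → S n′ x
    back (s , h , k) = from (U′⇔units x) (Q.nonzero h , R.nonzero k) , trans (jacobi-n′ h k) (square-one s)

  L⇔sameSign : ∀ x → L n p x ⇔ (SameSign (ι x) × ι x P.≉ 0ℤ)
  L⇔sameSign x = mk⇔ forth back
    where
    forth : L n p x → SameSign (ι x) × ι x P.≉ 0ℤ
    forth (u , j) =
      let (a , b) , c = to (U⇔units x) u
          s , h = Q.sign-of a
          t , k = R.sign-of b
          w , l = P.sign-of c
          s≡t = signs-agree′ s t w (trans (sym (jacobi-n h k l)) (trans j (jacobi-p l)))
      in (s , h , subst (λ t → R.HasSign t (ι x)) (sym s≡t) k) , c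
    back : SameSign (ι x) × ι x P.≉ 0ℤ → L n p x
    back ((s , h , k) , c) =
      let w , l = P.sign-of c
      in from (U⇔units x) ((Q.nonzero h , R.nonzero k) , c) ,
         trans (jacobi-n h k l) (trans (square-one′ s w) (sym (jacobi-p l)))

  letter : ℤ → Letter
  letter x = pairLetter x , UP.unitLetter x

  private
    isUnit-fst : ∀ c d → isUnit c ≡ isUnit (fst (classPair c d))
    isUnit-fst zero     zero     = refl
    isUnit-fst (unit _) zero     = refl
    isUnit-fst zero     (unit _) = refl
    isUnit-fst (unit _) (unit _) = refl

    isUnit-snd : ∀ c d → isUnit d ≡ isUnit (snd (classPair c d))
    isUnit-snd zero     zero     = refl
    isUnit-snd (unit _) zero     = refl
    isUnit-snd zero     (unit _) = refl
    isUnit-snd (unit _) (unit _) = refl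

    unitLetters : ∀ x → (UQ.unitLetter x , UR.unitLetter x) ≡ unitPair (pairLetter x)
    unitLetters x = cong₂ _,_ (isUnit-fst (proj₁ (Q.class-of x)) (proj₁ (R.class-of x)))
                              (isUnit-snd (proj₁ (Q.class-of x)) (proj₁ (R.class-of x)))

    ≡⇒T⇔T : ∀ {b c} → b ≡ c → T b ⇔ T c
    ≡⇒T⇔T refl = mk⇔ id id

  hasL⇔ : ∀ xs → HasWeightedZeroSumSubsequence (L n p) xs ⇔ T (accepts (jacobiAutomaton Q.κ R.κ) (map letter (map ι xs)))
  hasL⇔ xs = ⇔-trans
    (Residues.hasWeightedZeroSumSubsequence⇔zeroSum n L⇔sameSign (Model.weight-resp L-model) xs)
    (⇔-sym (Model.accepts⇔zeroSum L-model))

  hasS⇔ : ∀ xs → HasWeightedZeroSumSubsequence (S n′) xs ⇔ T (accepts (pairAutomaton Q.κ R.κ) (map pairLetter (map ι xs)))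
  hasS⇔ xs = ⇔-trans
    (Residues.hasWeightedZeroSumSubsequence⇔zeroSum n′ S⇔sameSign (Model.weight-resp S-model) xs)
    (⇔-sym (Model.accepts⇔zeroSum S-model))

  hasU⇔ : ∀ xs → HasWeightedZeroSumSubsequence (U n) xs ⇔ T (acceptsU (map letter (map ι xs)))
  hasU⇔ xs = ⇔-trans
    (Residues.hasWeightedZeroSumSubsequence⇔zeroSum n U⇔units (Model.weight-resp U-model) xs)
    (⇔-trans (⇔-sym (Model.accepts⇔zeroSum U-model)) (≡⇒T⇔T (cong (Automaton.accepts _)
      (trans (map-cong (λ x → cong (_, UP.unitLetter x) (unitLetters x)) (map ι xs)) (map-∘ (map ι xs))))))

  hasU′⇔ : ∀ xs → HasWeightedZeroSumSubsequence (U n′) xs ⇔ T (acceptsU′ (map pairLetter (map ι xs)))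
  hasU′⇔ xs = ⇔-trans
    (Residues.hasWeightedZeroSumSubsequence⇔zeroSum n′ U′⇔units (Model.weight-resp U′-model) xs)
    (⇔-trans (⇔-sym (Model.accepts⇔zeroSum U′-model)) (≡⇒T⇔T (cong (Automaton.accepts _)
      (trans (map-cong unitLetters (map ι xs)) (map-∘ (map ι xs))))))

  private
    0∉U : ¬ U n ⟦ 0 ⟧
    0∉U h = proj₂ (to (U⇔units ⟦ 0 ⟧) h) (∣⇒≈ p∣n (Residues.ι-⟦⟧ n 0))

    0∉U′ : ¬ U n′ ⟦ 0 ⟧
    0∉U′ h = proj₁ (to (U′⇔units ⟦ 0 ⟧) h) (∣⇒≈ q∣n′ (Residues.ι-⟦⟧ n′ 0))

  unitLetter⇔ : ∀ x → T (UP.unitLetter x) ⇔ (x P.≉ 0ℤ)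
  unitLetter⇔ x with UP.unitLetter x | UP.hasUnit x
  ... | true  | P.unit x≉0 = mk⇔ (λ _ → x≉0) (λ _ → tt)
  ... | false | P.zero x≈0 = mk⇔ (λ ()) (λ x≉0 → x≉0 x≈0)

  ¬unitLetter⇔ : ∀ x → (¬ T (UP.unitLetter x)) ⇔ (x P.≈ 0ℤ)
  ¬unitLetter⇔ x with UP.unitLetter x | UP.hasUnit x
  ... | true  | P.unit x≉0 = mk⇔ (λ ¬t → contradiction tt ¬t) (λ x≈0 → contradiction x≈0 x≉0)
  ... | false | P.zero x≈0 = mk⇔ (λ _ → x≈0) (λ _ ())

  pairLetter-resp : ∀ {x y} → x N′.≈ y → pairLetter x ≡ pairLetter y
  pairLetter-resp {x} {y} e = let eq , er = split-n′ e in
    cong₂ classPair (Q.class-unique (Q.class-resp eq (proj₂ (Q.class-of x))) (proj₂ (Q.class-of y)))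
                    (R.class-unique (R.class-resp er (proj₂ (R.class-of x))) (proj₂ (R.class-of y)))

  pairLetter-neither : ∀ x → T (isNeither (pairLetter x)) ⇔ (x N′.≈ 0ℤ)
  pairLetter-neither x with Q.class-of x | R.class-of x
  ... | zero   , Q.zero e | zero   , R.zero f = mk⇔ (λ _ → join-n′ e f) (λ _ → tt)
  ... | zero   , _        | unit _ , R.unit h = mk⇔ (λ ()) (λ e → R.nonzero h (proj₂ (split-n′ e)))
  ... | unit _ , Q.unit h | zero   , _        = mk⇔ (λ ()) (λ e → Q.nonzero h (proj₁ (split-n′ e)))
  ... | unit _ , Q.unit h | unit _ , _        = mk⇔ (λ ()) (λ e → Q.nonzero h (proj₁ (split-n′ e)))

  pairLetter-left : ∀ x → x Q.≉ 0ℤ → x R.≈ 0ℤ → pairLetter x ≡ left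
  pairLetter-left x x≉0 x≈0 with Q.class-of x | R.class-of x
  ... | zero   , Q.zero e | _                 = contradiction e x≉0
  ... | unit _ , _        | zero   , _        = refl
  ... | unit _ , _        | unit _ , R.unit h = contradiction x≈0 (R.nonzero h)

  pairLetter-right : ∀ x → x Q.≈ 0ℤ → x R.≉ 0ℤ → pairLetter x ≡ right
  pairLetter-right x x≈0 x≉0 with Q.class-of x | R.class-of x
  ... | unit _ , Q.unit h | _                 = contradiction x≈0 (Q.nonzero h)
  ... | zero   , _        | unit _ , _        = refl
  ... | zero   , _        | zero   , R.zero e = contradiction e x≉0

  private
    prime-≉0 : ∀ {k l} → Prime k → Prime l → k ≢ l → Congruence._≉_ (+ k) (+ l) 0ℤ
    prime-≉0 k-prime l-prime k≢l e =
      [ (λ { refl → ¬prime[1] k-prime }) , k≢l ]′ (prime⇒irreducible l-prime (PrimeField.≈0⇒∣ᵤ k-prime e))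

    multiple-≈0 : ∀ k l → Congruence._≈_ (+ k) (+ (k * l)) 0ℤ
    multiple-≈0 k l = Congruence.∣⇒≈0 (+ k) (ℤ∣.∣ᵤ⇒∣ (ℕ∣.m∣m*n l))

    T-resp : ∀ {A : Set} (f : A → Bool) {x y} → x ≡ y → T (f x) → T (f y)
    T-resp f refl h = h

  -- Free sequences and the four Davenport constants

  -- Each of n′, p r and p q is a unit modulo exactly one of the three primes.
  U-free : ∃[ w ] length w ≡ 3 × ¬ HasWeightedZeroSumSubsequence (U n) w
  U-free = ⟦ n′ ⟧ ∷ ⟦ p * r ⟧ ∷ ⟦ p * q ⟧ ∷ [] , refl , λ h →
    T-resp (λ (a , b , c) → acceptsU (a ∷ b ∷ c ∷ [])) letters (to (hasU⇔ _) h)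
    where
    module Z = Residues n
    value : ∀ a → ι {n} ⟦ a ⟧ N.≈ + a
    value = Z.ι-⟦⟧
    x₁ = ι {n} ⟦ n′ ⟧
    x₂ = ι {n} ⟦ p * r ⟧
    x₃ = ι {n} ⟦ p * q ⟧
    at-n′ : ∀ a → ι {n} ⟦ a ⟧ N′.≈ + a
    at-n′ a = ∣⇒≈ n′∣n (value a)
    at-q : ∀ a → ι {n} ⟦ a ⟧ Q.≈ + a
    at-q a = proj₁ (split-n′ (at-n′ a))
    at-r : ∀ a → ι {n} ⟦ a ⟧ R.≈ + a
    at-r a = proj₂ (split-n′ (at-n′ a))
    at-p : ∀ a → ι {n} ⟦ a ⟧ P.≈ + a
    at-p a = ∣⇒≈ p∣n (value a)
    product≉0 : ∀ {k a b} → (k-prime : Prime k) → Congruence._≉_ (+ k) (+ a) 0ℤ → Congruence._≉_ (+ k) (+ b) 0ℤ →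
      Congruence._≉_ (+ k) (+ (a * b)) 0ℤ
    product≉0 {a = a} {b} k-prime a≉0 b≉0 e = PrimeField.*-≉0 k-prime a≉0 b≉0
      (Congruence.≈-trans _ (Congruence.≈-reflexive _ (sym (ℤₚ.pos-* a b))) e)
    to-true : ∀ {b} → T b → b ≡ true
    to-true {true} _ = refl
    to-false : ∀ {b} → ¬ T b → b ≡ false
    to-false {false} _  = refl
    to-false {true}  ¬t = contradiction tt ¬t
    to-neither : ∀ {c} → T (isNeither c) → c ≡ neither
    to-neither {neither} _ = refl
    letter₁ : letter x₁ ≡ (neither , true)
    letter₁ = cong₂ _,_ (to-neither (from (pairLetter-neither x₁) (N′.≈-trans (at-n′ n′) (N′.∣⇒≈0 (ℤ∣.∣-refl)))))
      (to-true (from (unitLetter⇔ x₁) (P.≉0-resp (P.≈-sym (at-p n′))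
        (subst (λ k → + k P.≉ 0ℤ) (sym n′≡qr)
          (product≉0 p-prime (prime-≉0 p-prime q-prime (q≢p ∘ sym)) (prime-≉0 p-prime r-prime (r≢p ∘ sym)))))))
    letter₂ : letter x₂ ≡ (left , false)
    letter₂ = cong₂ _,_
      (pairLetter-left x₂
        (Q.≉0-resp (Q.≈-sym (at-q (p * r))) (product≉0 q-prime (prime-≉0 q-prime p-prime q≢p) (prime-≉0 q-prime r-prime q≢r)))
        (R.≈-trans (at-r (p * r)) (subst (λ k → + k R.≈ 0ℤ) (ℕₚ.*-comm r p) (multiple-≈0 r p))))
      (to-false (from (¬unitLetter⇔ x₂) (P.≈-trans (at-p (p * r)) (multiple-≈0 p r))))
    letter₃ : letter x₃ ≡ (right , false)
    letter₃ = cong₂ _,_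
      (pairLetter-right x₃
        (Q.≈-trans (at-q (p * q)) (subst (λ k → + k Q.≈ 0ℤ) (ℕₚ.*-comm q p) (multiple-≈0 q p)))
        (R.≉0-resp (R.≈-sym (at-r (p * q))) (product≉0 r-prime (prime-≉0 r-prime p-prime r≢p) (prime-≉0 r-prime q-prime (q≢r ∘ sym)))))
      (to-false (from (¬unitLetter⇔ x₃) (P.≈-trans (at-p (p * q)) (multiple-≈0 p q))))
    letters : (letter x₁ , letter x₂ , letter x₃) ≡ ((neither , true) , (left , false) , (right , false))
    letters = cong₂ _,_ letter₁ (cong₂ _,_ letter₂ letter₃)

  -- The term r is a unit modulo q only and q is a unit modulo r only, so no cancellation is
  -- possible. On the letters `left` and `right` the automaton evaluates to `false`.
  U′-free : ∃[ w ] length w ≡ 2 × ¬ HasWeightedZeroSumSubsequence (U n′) w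
  U′-free = ⟦ r ⟧ ∷ ⟦ q ⟧ ∷ [] , refl , λ h →
    T-resp (λ (a , b) → acceptsU′ (a ∷ b ∷ [])) (cong₂ _,_ letter₁ letter₂) (to (hasU′⇔ _) h)
    where
    x₁ = ι {n′} ⟦ r ⟧
    x₂ = ι {n′} ⟦ q ⟧
    at-q : ∀ a → ι {n′} ⟦ a ⟧ Q.≈ + a
    at-q a = proj₁ (split-n′ (Residues.ι-⟦⟧ n′ a))
    at-r : ∀ a → ι {n′} ⟦ a ⟧ R.≈ + a
    at-r a = proj₂ (split-n′ (Residues.ι-⟦⟧ n′ a))
    self : ∀ k → Congruence._≈_ (+ k) (+ k) 0ℤ
    self k = subst (λ l → Congruence._≈_ (+ k) (+ l) 0ℤ) (ℕₚ.*-identityʳ k) (multiple-≈0 k 1)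
    letter₁ : pairLetter x₁ ≡ left
    letter₁ = pairLetter-left x₁ (Q.≉0-resp (Q.≈-sym (at-q r)) (prime-≉0 q-prime r-prime q≢r)) (R.≈-trans (at-r r) (self r))
    letter₂ : pairLetter x₂ ≡ right
    letter₂ = pairLetter-right x₂ (Q.≈-trans (at-q q) (self q)) (R.≉0-resp (R.≈-sym (at-r q)) (prime-≉0 r-prime q-prime (q≢r ∘ sym)))

  L⊆U : ∀ {x} → L n p x → U n x
  L⊆U = proj₁

  S⊆U′ : ∀ {x} → S n′ x → U n′ x
  S⊆U′ = proj₁

  everyL : EverySequenceOfLength (L n p) 4
  everyL xs@(w ∷ x ∷ y ∷ z ∷ []) refl =
    from (hasL⇔ xs) (accepts-four Q.κ R.κ (letter (ι w)) (letter (ι x)) (letter (ι y)) (letter (ι z)))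

  everyS : EverySequenceOfLength (S n′) 3
  everyS xs@(x ∷ y ∷ z ∷ []) refl = from (hasS⇔ xs)
    (accepts-three Q.κ R.κ (pairLetter (ι x)) (pairLetter (ι y)) (pairLetter (ι z)))

  -- As `L` is contained in `U`, the upper bound for `L` also serves `U`, and the free sequence for
  -- `U` also serves `L`. Both constants are therefore 4, and extremal sequences for either set have
  -- length 3. The constants of `S` and `U` modulo n′ are both 3 in the same way.
  extremalU⇔ : ∀ xs → IsDExtremal (U n) xs ⇔ (length xs ≡ 3 × ¬ HasWeightedZeroSumSubsequence (U n) xs)
  extremalU⇔ = let w , len , ¬w = U-free in isDExtremal⇔ 0∉U
    (davenportConstant (λ xs len → hasWeightedZeroSumSubsequence-mono L⊆U (everyL xs len)) w len ¬w)

  extremalL⇔ : ∀ xs → IsDExtremal (L n p) xs ⇔ (length xs ≡ 3 × ¬ HasWeightedZeroSumSubsequence (L n p) xs)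
  extremalL⇔ = let w , len , ¬w = U-free in isDExtremal⇔ (0∉U ∘ L⊆U)
    (davenportConstant everyL w len (¬w ∘ hasWeightedZeroSumSubsequence-mono L⊆U))

  extremalU′⇔ : ∀ xs → IsDExtremal (U n′) xs ⇔ (length xs ≡ 2 × ¬ HasWeightedZeroSumSubsequence (U n′) xs)
  extremalU′⇔ = let w , len , ¬w = U′-free in isDExtremal⇔ 0∉U′
    (davenportConstant (λ xs len → hasWeightedZeroSumSubsequence-mono S⊆U′ (everyS xs len)) w len ¬w)

  extremalS⇔ : ∀ xs → IsDExtremal (S n′) xs ⇔ (length xs ≡ 2 × ¬ HasWeightedZeroSumSubsequence (S n′) xs)
  extremalS⇔ = let w , len , ¬w = U′-free in isDExtremal⇔ (0∉U′ ∘ S⊆U′)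
    (davenportConstant everyS w len (¬w ∘ hasWeightedZeroSumSubsequence-mono S⊆U′))

  -- The exceptional forms and the characterisation for three given primes

  ExceptionalForm : ℤ/ n → ℤ/ n → ℤ/ n → Set
  ExceptionalForm x₁ x₂ x₃ =
    ( ( IsDExtremal (S n′) (map (reduce n n′) (x₁ ∷ x₂ ∷ []))
      × x₃ ≢ ⟦ 0 ⟧ × ⟦ n′ ⟧ ∣ₘ x₃ )
    ⊎ ( ¬ (⟦ p ⟧ ∣ₘ x₁) × ⟦ p ⟧ ∣ₘ x₂ × ⟦ p ⟧ ∣ₘ x₃
      × IsDExtremal (S n′) (map (reduce n n′) (x₂ ∷ x₃ ∷ []))
      × ¬ IsDExtremal (U n′) (map (reduce n n′) (x₂ ∷ x₃ ∷ [])) ) )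

  private
    reduce-letter : ∀ x → pairLetter (ι (reduce n n′ x)) ≡ pairLetter (ι x)
    reduce-letter x = pairLetter-resp (Residues.ι-⟦⟧ n′ (toℕ x))

    reduced : ∀ x y → map pairLetter (map ι (map (reduce n n′) (x ∷ y ∷ []))) ≡ pairLetter (ι x) ∷ pairLetter (ι y) ∷ []
    reduced x y = cong₂ (λ c d → c ∷ d ∷ []) (reduce-letter x) (reduce-letter y)

    reducedS : ∀ x y → IsDExtremal (S n′) (map (reduce n n′) (x ∷ y ∷ [])) ⇔
      (¬ T (accepts (pairAutomaton Q.κ R.κ) (pairLetter (ι x) ∷ pairLetter (ι y) ∷ [])))
    reducedS x y = mk⇔
      (λ ext → proj₂ (to (extremalS⇔ _) ext) ∘ from (hasS⇔ _) ∘ T-resp (accepts (pairAutomaton Q.κ R.κ)) (sym (reduced x y)))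
      (λ h → from (extremalS⇔ _) (refl , h ∘ T-resp (accepts (pairAutomaton Q.κ R.κ)) (reduced x y) ∘ to (hasS⇔ _)))

    -- The length is already right, so failing to be extremal can only mean having a zero sum; the
    -- double negation disappears because acceptance is decidable.
    reducedU′ : ∀ x y → (¬ IsDExtremal (U n′) (map (reduce n n′) (x ∷ y ∷ []))) ⇔
      T (acceptsU′ (pairLetter (ι x) ∷ pairLetter (ι y) ∷ []))
    reducedU′ x y = mk⇔
      (λ ¬ext → T-stable (λ ¬h → ¬ext (from (extremalU′⇔ _)
        (refl , ¬h ∘ T-resp acceptsU′ (reduced x y) ∘ to (hasU′⇔ _)))))
      (λ h ext → proj₂ (to (extremalU′⇔ _) ext) (from (hasU′⇔ _) (T-resp acceptsU′ (sym (reduced x y)) h)))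
      where
      T-stable : ∀ {b} → ¬ ¬ T b → T b
      T-stable {true}  _   = tt
      T-stable {false} ¬¬t = ¬¬t id

    p∣ₘ⇔ : ∀ x → (⟦ p ⟧ ∣ₘ x) ⇔ (ι {n} x P.≈ 0ℤ)
    p∣ₘ⇔ x = Residues.∣ₘ⇔≈0 n p∣n

    n′∣ₘ⇔ : ∀ x → (⟦ n′ ⟧ ∣ₘ x) ⇔ (ι {n} x N′.≈ 0ℤ)
    n′∣ₘ⇔ x = Residues.∣ₘ⇔≈0 n n′∣n

  -- In the first form, a multiple of n′ is nonzero modulo n exactly when it is a unit modulo p,
  -- since n′ and p are coprime.
  exceptionalForm⇔ : ∀ x y z → Exceptional Q.κ R.κ (letter (ι x)) (letter (ι y)) (letter (ι z)) ⇔ ExceptionalForm x y z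
  exceptionalForm⇔ x y z =
    mk⇔
      [ (λ (s , u , e) → inj₁ (from (reducedS x y) s ,
          (λ z≡0 → to (unitLetter⇔ (ι z)) u (∣⇒≈ p∣n (Residues.≡⟦⟧⇒ι≈ n z≡0))) ,
          from (n′∣ₘ⇔ z) (to (pairLetter-neither (ι z)) e)))
      , (λ (i , j , k , s , u) → inj₂ (to (unitLetter⇔ (ι x)) i ∘ to (p∣ₘ⇔ x) ,
          from (p∣ₘ⇔ y) (to (¬unitLetter⇔ (ι y)) j) , from (p∣ₘ⇔ z) (to (¬unitLetter⇔ (ι z)) k) ,
          from (reducedS y z) s , from (reducedU′ y z) u)) ]′
      [ (λ (s , z≢0 , n′∣z) → let z≈0 = to (n′∣ₘ⇔ z) n′∣z in inj₁ (to (reducedS x y) s ,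
          from (unitLetter⇔ (ι z)) (λ e → z≢0 (Residues.ι≈⇒≡⟦⟧ n (join-n z≈0 e))) ,
          from (pairLetter-neither (ι z)) z≈0))
      , (λ (p∤x , p∣y , p∣z , s , u) → inj₂ (from (unitLetter⇔ (ι x)) (p∤x ∘ from (p∣ₘ⇔ x)) ,
          from (¬unitLetter⇔ (ι y)) (to (p∣ₘ⇔ y) p∣y) , from (¬unitLetter⇔ (ι z)) (to (p∣ₘ⇔ z) p∣z) ,
          to (reducedS y z) s , to (reducedU′ y z) u)) ]′

  extremal-characterisation : (xs : List (ℤ/ n)) → IsDExtremal (L n p) xs ⇔
    ( IsDExtremal (U n) xs
    ⊎ ∃[ x₁ ] ∃[ x₂ ] ∃[ x₃ ] ( xs ↭ (x₁ ∷ x₂ ∷ x₃ ∷ []) × ExceptionalForm x₁ x₂ x₃ ) )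
  extremal-characterisation xs = mk⇔ (λ ext → let len , ¬z = to (extremalL⇔ xs) ext in forth xs len ¬z) back
    where
    HasForm : List (ℤ/ n) → Set
    HasForm xs = ∃[ x₁ ] ∃[ x₂ ] ∃[ x₃ ] ( xs ↭ (x₁ ∷ x₂ ∷ x₃ ∷ []) × ExceptionalForm x₁ x₂ x₃ )
    forth : ∀ xs → length xs ≡ 3 → ¬ HasWeightedZeroSumSubsequence (L n p) xs → IsDExtremal (U n) xs ⊎ HasForm xs
    forth xs@(x ∷ y ∷ z ∷ []) refl ¬z =
      [ (λ ¬u → inj₁ (from (extremalU⇔ xs) (refl , ¬u ∘ to (hasU⇔ xs))))
      , [ (λ f → inj₂ (x , y , z , Perm.refl , to (exceptionalForm⇔ x y z) f))
        , [ (λ f → inj₂ (y , z , x , ↭-sym (Permₚ.shift x (y ∷ z ∷ []) []) , to (exceptionalForm⇔ y z x) f))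
          , (λ f → inj₂ (z , x , y , Permₚ.shift z (x ∷ y ∷ []) [] , to (exceptionalForm⇔ z x y) f))
          ]′ ]′ ]′ (classify Q.κ R.κ (letter (ι x)) (letter (ι y)) (letter (ι z)) (¬z ∘ from (hasL⇔ xs)))
    back : IsDExtremal (U n) xs ⊎ HasForm xs → IsDExtremal (L n p) xs
    back (inj₁ ext) = let len , ¬z = to (extremalU⇔ xs) ext
      in from (extremalL⇔ xs) (len , ¬z ∘ hasWeightedZeroSumSubsequence-mono L⊆U)
    back (inj₂ (x , y , z , π , f)) = from (extremalL⇔ xs) (Permₚ.↭-length π , λ h →
      exceptional⇒¬accepts Q.κ R.κ (letter (ι x)) (letter (ι y)) (letter (ι z)) (from (exceptionalForm⇔ x y z) f)
        (to (hasL⇔ (x ∷ y ∷ z ∷ [])) (permute h)))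
      where
      zeroSum⇔ : ∀ ys → HasWeightedZeroSumSubsequence (L n p) ys ⇔ ZeroSum n (λ u → SameSign u × u P.≉ 0ℤ) (map ι ys)
      zeroSum⇔ = Residues.hasWeightedZeroSumSubsequence⇔zeroSum n L⇔sameSign (Model.weight-resp L-model)
      permute : HasWeightedZeroSumSubsequence (L n p) xs → HasWeightedZeroSumSubsequence (L n p) (x ∷ y ∷ z ∷ [])
      permute h = from (zeroSum⇔ _) (zeroSum-↭ (Permₚ.map⁺ ι π) (to (zeroSum⇔ xs) h))

-- Reduction to three distinct primes

cofactors : ∀ {n p′} ps → length ps ≡ 3 → All Prime ps → n ≡ product ps → p′ ∈ ps →
  ∃₂ λ q r → Prime q × Prime r × n ≡ q * r * p′
cofactors (a ∷ b ∷ c ∷ []) refl (_ ∷ pb ∷ pc ∷ []) refl (here refl) = b , c , pb , pc , rearrange a b c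
  where
  rearrange : ∀ a b c → a * (b * (c * 1)) ≡ b * c * a
  rearrange = ℕ-solve-∀
cofactors (a ∷ b ∷ c ∷ []) refl (pa ∷ _ ∷ pc ∷ []) refl (there (here refl)) = a , c , pa , pc , rearrange a b c
  where
  rearrange : ∀ a b c → a * (b * (c * 1)) ≡ a * c * b
  rearrange = ℕ-solve-∀
cofactors (a ∷ b ∷ c ∷ []) refl (pa ∷ pb ∷ _ ∷ []) refl (there (there (here refl))) = a , b , pa , pb , rearrange a b c
  where
  rearrange : ∀ a b c → a * (b * (c * 1)) ≡ a * b * c
  rearrange = ℕ-solve-∀

squarefree⇒≢ : ∀ {n p q m} → Squarefree n → Prime p → n ≡ p * q * m → p ≢ q
squarefree⇒≢ {p = p} {m = m} sf p-prime refl refl = contradiction (subst Prime (sf p (ℕ∣.m∣m*n m)) p-prime) ¬prime[1]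

theorem6p4 : (n p′ n′ : ℕ) .{{_ : NonZero n}} .{{_ : NonZero p′}} .{{_ : NonZero n′}} →
    Squarefree n →
    (∀ p → Prime p → p ∣ n → 7 ≤ p) →
    Prime p′ →
    n ≡ n′ * p′ →
    Ω n ≡ 3 →
    (xs : List (ℤ/ n)) →
    IsDExtremal (L n p′) xs ⇔
    ( IsDExtremal (U n) xs
    ⊎ ∃[ x₁ ] ∃[ x₂ ] ∃[ x₃ ]
    ( xs ↭ (x₁ ∷ x₂ ∷ x₃ ∷ [])
    × ( ( IsDExtremal (S n′) (map (reduce n n′) (x₁ ∷ x₂ ∷ []))
    × x₃ ≢ ⟦ 0 ⟧ × ⟦ n′ ⟧ ∣ₘ x₃ )
    ⊎ ( ¬ (⟦ p′ ⟧ ∣ₘ x₁) × ⟦ p′ ⟧ ∣ₘ x₂ × ⟦ p′ ⟧ ∣ₘ x₃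
    × IsDExtremal (S n′) (map (reduce n n′) (x₂ ∷ x₃ ∷ []))
    × ¬ IsDExtremal (U n′) (map (reduce n n′) (x₂ ∷ x₃ ∷ [])) ) ) ) )
theorem6p4 n p′ n′ sf 7≤ p′-prime n≡n′p′ Ωn≡3 =
  let open PrimeFactorisation (factorise n)
      q , r , q-prime , r-prime , n≡qrp′ = cofactors factors Ωn≡3 factorsPrime isFactorisation
        (factorisationHasAllPrimeFactors p′-prime
          (subst (p′ ∣_) (trans (sym n≡n′p′) isFactorisation) (ℕ∣.n∣m*n n′)) factorsPrime)
      n≡qp′r = trans n≡qrp′ (swap-last q r)
      n≡rp′q = trans n≡qrp′ (rotate q r)
  in ThreePrimes.extremal-characterisation q-prime r-prime p′-prime
       (7≤ q q-prime (subst (q ∣_) (sym n≡qp′r) (ℕ∣.∣m⇒∣m*n r (ℕ∣.m∣m*n p′))))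
       (7≤ r r-prime (subst (r ∣_) (sym n≡qp′r) (ℕ∣.n∣m*n (q * p′))))
       (7≤ p′ p′-prime (subst (p′ ∣_) (sym n≡n′p′) (ℕ∣.n∣m*n n′)))
       -- Each rearrangement of the product puts another pair of primes in front; if the two were
       -- equal, their product would be a square dividing n.
       (squarefree⇒≢ sf q-prime n≡qrp′) (squarefree⇒≢ sf q-prime n≡qp′r) (squarefree⇒≢ sf r-prime n≡rp′q)
       (ℕₚ.*-cancelʳ-≡ n′ (q * r) p′ (trans (sym n≡n′p′) n≡qrp′)) n≡n′p′
  where
  swap-last : ∀ q r → q * r * p′ ≡ q * p′ * r
  swap-last q r = trans (ℕₚ.*-assoc q r p′) (trans (cong (q *_) (ℕₚ.*-comm r p′)) (sym (ℕₚ.*-assoc q p′ r)))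
  rotate : ∀ q r → q * r * p′ ≡ r * p′ * q
  rotate q r = trans (ℕₚ.*-assoc q r p′) (ℕₚ.*-comm q (r * p′))
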